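{- For every $k\ge 1$ there is a constant $L$ (depending only on $k$) such that the following holds. If a Viterbi sequence for $k$-state Markov chains, arranged into prefix, periodic interior and suffix, has an interior of period $p$ with at least $L$ transitions, then the prefix has at most $kp$ transitions and the suffix has at most $kp$ transitions.
   Context: A $k$-state Markov chain has states $0,1,\dots,k-1$, an initial distribution $(\pi_i)$ and a stochastic transition matrix $(p_{ij})$. The space $\mathcal M_k$ of all such chains is a product of $k+1$ simplices of dimension $k-1$, and carries Lebesgue measure. A sequence of length $n$ is a sequence of states $s_0s_1\cdots s_n$ (with $n$ transitions); its probability is $\Pr[s_0\cdots s_n]=\pi_{s_0}\prod_{t=1}^n p_{s_{t-1}s_t}$. A Viterbi path of length $n$ of a Markov chain is a sequence of length $n$ of maximal probability. Two Markov chains are in the same region (for given $n$) iff they have the same set of Viterbi paths of length $n$; a Viterbi region is a region of positive measure in $\mathcal M_k$. A Viterbi sequence of length $n$ is a sequence that is a Viterbi path for (the chains of) some Viterbi region. Two sequences of the same length are equivalent if they have the same initial state and the same multiset of transitions $(s_{t-1},s_t)$; any sequence equivalent to a Viterbi sequence is a rearrangement of it. Arrangement into prefix, interior, suffix: given a cycle $c_0\to c_1\to\cdots\to c_{p-1}\to c_0$ on $p$ distinct states ($1\le p\le k$), the sequence is written as $s_0\cdots s_a\cdots s_b\cdots s_n$, where the transitions from $s_a$ to $s_b$ all follow the cycle consecutively (the number $b-a$ need not be a multiple of $p$). The prefix is $s_0\cdots s_a$ ($a$ transitions), the interior is $s_a\cdots s_b$ ($b-a$ transitions, period $p$), and the suffix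 is $s_b\cdots s_n$ ($n-b$ transitions). The length of the interior is required to be maximal among all such decompositions, for this cycle, of all sequences equivalent to the given one; in particular neither the prefix nor the suffix contains a contiguous block of $p$ transitions that is a full traversal of the cycle. -}

module Defs where

open import Data.Fin.Base using (Fin; zero; suc; toℕ; inject₁)
open import Data.List.Base using (List; tabulate)
open import Data.List.Relation.Binary.Permutation.Propositional using (_↭_)
open import Data.Maybe.Base using (Maybe; maybe)
open import Data.Maybe.Relation.Unary.Any using (Any)
open import Data.Nat.Base using (ℕ; zero; suc; pred)
import Data.Nat.Base as ℕ
import Data.Nat.Properties as ℕₚ
open import Data.Nat.DivMod using (_mod_)
open import Data.Product.Base using (∃-syntax; _×_; _,_; proj₁; proj₂)
open import Data.Rational.Base as ℚ using (ℚ; 0ℚ; 1ℚ; ½; ∣_∣; 1/_)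
import Data.Rational.Properties as ℚₚ
open import Data.Rational.Solver using (module +-*-Solver)
open import Data.Vec.Functional using (foldr)
open import Function.Bundles using (_⇔_)
open import Relation.Binary.PropositionalEquality using (_≡_; refl; sym; trans; cong; cong₂; subst)
open import Relation.Nullary.Negation using (¬_)

IsCauchy : (ℕ → ℚ) → Set
IsCauchy x = ∀ ε → 0ℚ ℚ.< ε →
  ∃[ N ] (∀ m n → N ℕ.≤ m → N ℕ.≤ n → ∣ x m ℚ.- x n ∣ ℚ.≤ ε)

-- A setoid under _≈ᴿ_.
record ℝ : Set where
  constructor mkℝ
  field
    seq    : ℕ → ℚ
    cauchy : IsCauchy seq

open ℝ public

infix 4 _≤ᴿ_ _≈ᴿ_

_≤ᴿ_ : ℝ → ℝ → Set
x ≤ᴿ y = ∀ ε → 0ℚ ℚ.< ε → ∃[ N ] (∀ n → N ℕ.≤ n → seq x n ℚ.≤ seq y n ℚ.+ ε)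

_≈ᴿ_ : ℝ → ℝ → Set
x ≈ᴿ y = x ≤ᴿ y × y ≤ᴿ x

fromℚ : ℚ → ℝ
fromℚ q = mkℝ (λ _ → q) λ ε ε>0 → 0 , λ _ _ _ _ →
  ℚₚ.≤-trans (ℚₚ.≤-reflexive (cong ∣_∣ (ℚₚ.+-inverseʳ q))) (ℚₚ.<⇒≤ ε>0)

0ᴿ 1ᴿ : ℝ
0ᴿ = fromℚ 0ℚ
1ᴿ = fromℚ 1ℚ

private
  open ℚₚ.≤-Reasoning

  abstract
    half>0 : ∀ ε → 0ℚ ℚ.< ε → 0ℚ ℚ.< ½ ℚ.* ε
    half>0 ε ε>0 =
      subst (ℚ._< ½ ℚ.* ε) (ℚₚ.*-zeroʳ ½) (ℚₚ.*-monoʳ-<-pos ½ ε>0)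

    half+half : ∀ ε → ½ ℚ.* ε ℚ.+ ½ ℚ.* ε ≡ ε
    half+half ε = trans (sym (ℚₚ.*-distribʳ-+ ε ½ ½)) (ℚₚ.*-identityˡ ε)

    +-split : ∀ a b c d → (a ℚ.+ b) ℚ.- (c ℚ.+ d) ≡ (a ℚ.- c) ℚ.+ (b ℚ.- d)
    +-split = solve 4 (λ a b c d → (a :+ b) :- (c :+ d) := (a :- c) :+ (b :- d)) refl
      where open +-*-Solver

    *-split : ∀ a b c d →
      (a ℚ.* b) ℚ.- (c ℚ.* d) ≡ a ℚ.* (b ℚ.- d) ℚ.+ d ℚ.* (a ℚ.- c)
    *-split = solve 4 (λ a b c d →
      (a :* b) :- (c :* d) := a :* (b :- d) :+ d :* (a :- c)) refl
      where open +-*-Solver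

    sub-add : ∀ a b → a ≡ b ℚ.+ (a ℚ.- b)
    sub-add = solve 2 (λ a b → a := b :+ (a :- b)) refl
      where open +-*-Solver

    scale : ∀ K → 0ℚ ℚ.< K → ∀ ε → 0ℚ ℚ.< ε → ∃[ δ ] (0ℚ ℚ.< δ × K ℚ.* δ ≡ ε)
    scale K K>0 ε ε>0 = r ℚ.* ε , pos , eq
      where
      instance
        K⁺ : ℚ.Positive K
        K⁺ = ℚ.positive K>0
        K≠0 : ℚ.NonZero K
        K≠0 = ℚₚ.pos⇒nonZero K
      r : ℚ
      r = 1/ K
      instance
        r⁺ : ℚ.Positive r
        r⁺ = ℚₚ.1/pos⇒pos K
      pos : 0ℚ ℚ.< r ℚ.* ε
      pos = subst (ℚ._< r ℚ.* ε) (ℚₚ.*-zeroʳ r) (ℚₚ.*-monoʳ-<-pos r ε>0)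
      eq : K ℚ.* (r ℚ.* ε) ≡ ε
      eq = trans (sym (ℚₚ.*-assoc K r ε))
          (trans (cong (ℚ._* ε) (ℚₚ.*-inverseʳ K)) (ℚₚ.*-identityˡ ε))

    bounded : ∀ x → IsCauchy x →
      ∃[ K ] (0ℚ ℚ.< K × ∃[ N ] (∀ n → N ℕ.≤ n → ∣ x n ∣ ℚ.≤ K))
    bounded x cx with cx 1ℚ (ℚₚ.positive⁻¹ 1ℚ)
    ... | N , near = ∣ x N ∣ ℚ.+ 1ℚ , K>0 , N , bound
      where
      K>0 : 0ℚ ℚ.< ∣ x N ∣ ℚ.+ 1ℚ
      K>0 = ℚₚ.+-mono-≤-< (ℚₚ.0≤∣p∣ (x N)) (ℚₚ.positive⁻¹ 1ℚ)
      bound : ∀ n → N ℕ.≤ n → ∣ x n ∣ ℚ.≤ ∣ x N ∣ ℚ.+ 1ℚ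
      bound n N≤n = begin
        ∣ x n ∣                          ≡⟨ cong ∣_∣ (sub-add (x n) (x N)) ⟩
        ∣ x N ℚ.+ (x n ℚ.- x N) ∣        ≤⟨ ℚₚ.∣p+q∣≤∣p∣+∣q∣ (x N) (x n ℚ.- x N) ⟩
        ∣ x N ∣ ℚ.+ ∣ x n ℚ.- x N ∣      ≤⟨ ℚₚ.+-monoʳ-≤ ∣ x N ∣ (near n N N≤n ℕₚ.≤-refl) ⟩
        ∣ x N ∣ ℚ.+ 1ℚ                   ∎

    ∣*∣-mono : ∀ a b {K δ} → ∣ a ∣ ℚ.≤ K → ∣ b ∣ ℚ.≤ δ → ∣ a ℚ.* b ∣ ℚ.≤ K ℚ.* δ
    ∣*∣-mono a b {K} {δ} a≤K b≤δ = begin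
      ∣ a ℚ.* b ∣        ≡⟨ ℚₚ.∣p*q∣≡∣p∣*∣q∣ a b ⟩
      ∣ a ∣ ℚ.* ∣ b ∣    ≤⟨ ℚₚ.*-monoʳ-≤-nonNeg ∣ b ∣ {{ℚₚ.∣-∣-nonNeg b}} a≤K ⟩
      K ℚ.* ∣ b ∣        ≤⟨ ℚₚ.*-monoˡ-≤-nonNeg K {{ℚ.nonNegative (ℚₚ.≤-trans (ℚₚ.0≤∣p∣ a) a≤K)}} b≤δ ⟩
      K ℚ.* δ            ∎

    +-cauchy : ∀ x y → IsCauchy x → IsCauchy y → IsCauchy (λ n → x n ℚ.+ y n)
    +-cauchy x y cx cy ε ε>0
      with cx (½ ℚ.* ε) (half>0 ε ε>0) | cy (½ ℚ.* ε) (half>0 ε ε>0)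
    ... | M , nearx | N , neary = M ℕ.⊔ N , λ m n ≤m ≤n → begin
      ∣ (x m ℚ.+ y m) ℚ.- (x n ℚ.+ y n) ∣        ≡⟨ cong ∣_∣ (+-split (x m) (y m) (x n) (y n)) ⟩
      ∣ (x m ℚ.- x n) ℚ.+ (y m ℚ.- y n) ∣        ≤⟨ ℚₚ.∣p+q∣≤∣p∣+∣q∣ (x m ℚ.- x n) (y m ℚ.- y n) ⟩
      ∣ x m ℚ.- x n ∣ ℚ.+ ∣ y m ℚ.- y n ∣        ≤⟨ ℚₚ.+-mono-≤
                                                      (nearx m n (ℕₚ.m⊔n≤o⇒m≤o M N ≤m) (ℕₚ.m⊔n≤o⇒m≤o M N ≤n))
                                                      (neary m n (ℕₚ.m⊔n≤o⇒n≤o M N ≤m) (ℕₚ.m⊔n≤o⇒n≤o M N ≤n)) ⟩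
      ½ ℚ.* ε ℚ.+ ½ ℚ.* ε                        ≡⟨ half+half ε ⟩
      ε                                          ∎

    *-near : ∀ a b c d {K J α β} →
      ∣ a ∣ ℚ.≤ K → ∣ d ∣ ℚ.≤ J → ∣ b ℚ.- d ∣ ℚ.≤ α → ∣ a ℚ.- c ∣ ℚ.≤ β →
      ∣ (a ℚ.* b) ℚ.- (c ℚ.* d) ∣ ℚ.≤ K ℚ.* α ℚ.+ J ℚ.* β
    *-near a b c d {K} {J} {α} {β} a≤K d≤J bd≤α ac≤β = begin
      ∣ (a ℚ.* b) ℚ.- (c ℚ.* d) ∣
        ≡⟨ cong ∣_∣ (*-split a b c d) ⟩
      ∣ a ℚ.* (b ℚ.- d) ℚ.+ d ℚ.* (a ℚ.- c) ∣
        ≤⟨ ℚₚ.∣p+q∣≤∣p∣+∣q∣ (a ℚ.* (b ℚ.- d)) (d ℚ.* (a ℚ.- c)) ⟩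
      ∣ a ℚ.* (b ℚ.- d) ∣ ℚ.+ ∣ d ℚ.* (a ℚ.- c) ∣
        ≤⟨ ℚₚ.+-mono-≤ (∣*∣-mono a (b ℚ.- d) a≤K bd≤α) (∣*∣-mono d (a ℚ.- c) d≤J ac≤β) ⟩
      K ℚ.* α ℚ.+ J ℚ.* β ∎

    *-cauchy : ∀ x y → IsCauchy x → IsCauchy y → IsCauchy (λ n → x n ℚ.* y n)
    *-cauchy x y cx cy ε ε>0 = from (bounded x cx) (bounded y cy)
      where
      Bound : (ℕ → ℚ) → Set
      Bound z = ∃[ K ] (0ℚ ℚ.< K × ∃[ N ] (∀ n → N ℕ.≤ n → ∣ z n ∣ ℚ.≤ K))

      η : ℚ
      η = ½ ℚ.* ε

      from : Bound x → Bound y →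
        ∃[ N ] (∀ m n → N ℕ.≤ m → N ℕ.≤ n → ∣ (x m ℚ.* y m) ℚ.- (x n ℚ.* y n) ∣ ℚ.≤ ε)
      from (K , K>0 , M₁ , x≤K) (J , J>0 , N₁ , y≤J) =
        near (scale K K>0 η (half>0 ε ε>0)) (scale J J>0 η (half>0 ε ε>0))
        where
        near : ∃[ α ] (0ℚ ℚ.< α × K ℚ.* α ≡ η) → ∃[ β ] (0ℚ ℚ.< β × J ℚ.* β ≡ η) →
          ∃[ N ] (∀ m n → N ℕ.≤ m → N ℕ.≤ n → ∣ (x m ℚ.* y m) ℚ.- (x n ℚ.* y n) ∣ ℚ.≤ ε)
        near (α , α>0 , Kα) (β , β>0 , Jβ) = (M₁ ℕ.⊔ N₁) ℕ.⊔ (M₂ ℕ.⊔ N₂) , λ m n ≤m ≤n →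
          ℚₚ.≤-trans
            (*-near (x m) (y m) (x n) (y n)
              (x≤K m (ℕₚ.m⊔n≤o⇒m≤o M₁ N₁ (left ≤m)))
              (y≤J n (ℕₚ.m⊔n≤o⇒n≤o M₁ N₁ (left ≤n)))
              (proj₂ (cy α α>0) m n (ℕₚ.m⊔n≤o⇒n≤o M₂ N₂ (right ≤m)) (ℕₚ.m⊔n≤o⇒n≤o M₂ N₂ (right ≤n)))
              (proj₂ (cx β β>0) m n (ℕₚ.m⊔n≤o⇒m≤o M₂ N₂ (right ≤m)) (ℕₚ.m⊔n≤o⇒m≤o M₂ N₂ (right ≤n))))
            (ℚₚ.≤-reflexive (trans (cong₂ ℚ._+_ Kα Jβ) (half+half ε)))
          where
          M₂ N₂ : ℕ
          M₂ = proj₁ (cx β β>0)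
          N₂ = proj₁ (cy α α>0)
          left : ∀ {m} → (M₁ ℕ.⊔ N₁) ℕ.⊔ (M₂ ℕ.⊔ N₂) ℕ.≤ m → M₁ ℕ.⊔ N₁ ℕ.≤ m
          left = ℕₚ.m⊔n≤o⇒m≤o (M₁ ℕ.⊔ N₁) (M₂ ℕ.⊔ N₂)
          right : ∀ {m} → (M₁ ℕ.⊔ N₁) ℕ.⊔ (M₂ ℕ.⊔ N₂) ℕ.≤ m → M₂ ℕ.⊔ N₂ ℕ.≤ m
          right = ℕₚ.m⊔n≤o⇒n≤o (M₁ ℕ.⊔ N₁) (M₂ ℕ.⊔ N₂)

infixl 6 _+ᴿ_
infixl 7 _*ᴿ_

_+ᴿ_ : ℝ → ℝ → ℝ
x +ᴿ y = mkℝ (λ n → seq x n ℚ.+ seq y n) (+-cauchy (seq x) (seq y) (cauchy x) (cauchy y))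

_*ᴿ_ : ℝ → ℝ → ℝ
x *ᴿ y = mkℝ (λ n → seq x n ℚ.* seq y n) (*-cauchy (seq x) (seq y) (cauchy x) (cauchy y))

∑ : ∀ {n} → (Fin n → ℝ) → ℝ
∑ = foldr _+ᴿ_ 0ᴿ

∏ : ∀ {n} → (Fin n → ℝ) → ℝ
∏ = foldr _*ᴿ_ 1ᴿ

ℝ^ : ℕ → ℕ → Set
ℝ^ r c = Fin r → Fin c → ℝ

-- Boxes in ℝ^(r × c).  Rational endpoints give the same outer measure as real ones.
record Box (r c : ℕ) : Set where
  field
    lower upper : Fin r → Fin c → ℚ
    lower≤upper : ∀ i j → lower i j ℚ.≤ upper i j

open Box public

_∈ᴮ_ : ∀ {r c} → ℝ^ r c → Box r c → Set
x ∈ᴮ B = ∀ i j → fromℚ (lower B i j) ≤ᴿ x i j × x i j ≤ᴿ fromℚ (upper B i j)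

volume : ∀ {r c} → Box r c → ℚ
volume B = foldr ℚ._*_ 1ℚ λ i → foldr ℚ._*_ 1ℚ λ j → upper B i j ℚ.- lower B i j

-- A countable family of boxes; 'nothing' is the empty set, which is not a
-- box (in dimension 0 every box has volume 1).
BoxFamily : ℕ → ℕ → Set
BoxFamily r c = ℕ → Maybe (Box r c)

partialVolume : ∀ {r c} → BoxFamily r c → ℕ → ℚ
partialVolume B zero    = 0ℚ
partialVolume B (suc N) = partialVolume B N ℚ.+ maybe volume 0ℚ (B N)

-- The existential is the classical one: no box containing x need be computed.
Covers : ∀ {r c} → BoxFamily r c → (ℝ^ r c → Set) → Set
Covers B A = ∀ x → A x → ¬ ¬ (∃[ i ] Any (x ∈ᴮ_) (B i))

-- Outer measure positive: some ε > 0 is exceeded by the total volume of every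
-- countable cover.  For measurable A this is positive Lebesgue measure.
PositiveMeasure : ∀ {r c} → (ℝ^ r c → Set) → Set
PositiveMeasure {r} {c} A =
  ∃[ ε ] (0ℚ ℚ.< ε ×
    (∀ (B : BoxFamily r c) → Covers B A → ¬ (∀ N → partialVolume B N ℚ.≤ ε)))

IsDistribution : ∀ {k} → (Fin k → ℝ) → Set
IsDistribution f = (∀ i → 0ᴿ ≤ᴿ f i) × ∑ f ≈ᴿ 1ᴿ

record MarkovChain (k : ℕ) : Set where
  field
    π              : Fin k → ℝ
    p              : Fin k → Fin k → ℝ
    π-distribution : IsDistribution π
    p-stochastic   : ∀ i → IsDistribution (p i)

open MarkovChain public

free : ∀ k → Fin (pred k) → Fin k
free (suc _) = inject₁

-- Affine coordinates on the product of k + 1 simplices of dimension k - 1: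
-- the last entry of each distribution is dropped.  Row 0 is the initial
-- distribution, row i + 1 is the i-th row of the transition matrix.
coordinates : ∀ {k} → MarkovChain k → ℝ^ (suc k) (pred k)
coordinates {k} M zero    j = π M (free k j)
coordinates {k} M (suc i) j = p M i (free k j)

-- Lebesgue measure on the space of chains is, up to a positive constant,
-- Lebesgue measure in these coordinates.
HasPositiveMeasure : ∀ {k} → (MarkovChain k → Set) → Set
HasPositiveMeasure {k} A =
  PositiveMeasure {suc k} {pred k} λ x → ∃[ M ] (A M × (∀ i j → x i j ≈ᴿ coordinates M i j))

-- s₀ s₁ ⋯ sₙ, with n transitions
Sequence : ℕ → ℕ → Set
Sequence k n = Fin (suc n) → Fin k

transition : ∀ {k n} → Sequence k n → Fin n → Fin k × Fin k
transition s t = s (inject₁ t) , s (suc t)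

Pr : ∀ {k n} → MarkovChain k → Sequence k n → ℝ
Pr M s = π M (s zero) *ᴿ ∏ λ t → p M (s (inject₁ t)) (s (suc t))

IsViterbiPath : ∀ {k n} → MarkovChain k → Sequence k n → Set
IsViterbiPath {k} {n} M s = (s′ : Sequence k n) → Pr M s′ ≤ᴿ Pr M s

SameRegion : ∀ {k} → ℕ → MarkovChain k → MarkovChain k → Set
SameRegion {k} n M M′ = (s : Sequence k n) → IsViterbiPath M s ⇔ IsViterbiPath M′ s

-- A region is given by any one of its chains M.
IsViterbiSequence : ∀ {k n} → Sequence k n → Set
IsViterbiSequence {k} {n} s =
  ∃[ M ] (HasPositiveMeasure {k} (SameRegion n M) × IsViterbiPath M s)

transitions : ∀ {k n} → Sequence k n → List (Fin k × Fin k)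
transitions s = tabulate (transition s)

Equivalent : ∀ {k n} → Sequence k n → Sequence k n → Set
Equivalent s s′ = s zero ≡ s′ zero × transitions s ↭ transitions s′

module _ {k q : ℕ} .{{_ : ℕ.NonZero q}} (c : Fin q → Fin k) where

  CycleTransition : Fin k × Fin k → Set
  CycleTransition e = ∃[ i ] e ≡ (c i , c (suc (toℕ i) mod q))

  -- s₀⋯s_a is the prefix, s_a⋯s_b the interior, s_b⋯sₙ the suffix.  When the
  -- states of the cycle are distinct, adjacent cycle transitions are
  -- automatically consecutive on the cycle.
  record Decomposition {n : ℕ} (s : Sequence k n) (a b : ℕ) : Set where
    field
      a≤b      : a ℕ.≤ b
      b≤n      : b ℕ.≤ n
      interior : ∀ (t : Fin n) → a ℕ.≤ toℕ t → toℕ t ℕ.< b → CycleTransition (transition s t)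

  record Arrangement {n : ℕ} (s : Sequence k n) (a b : ℕ) : Set where
    field
      decomposition : Decomposition s a b
      maximal       : ∀ (s′ : Sequence k n) a′ b′ → Equivalent s s′ → Decomposition s′ a′ b′ →
                      b′ ℕ.∸ a′ ℕ.≤ b ℕ.∸ a

{-# OPTIONS --safe #-}

-- Take L = k².  If the prefix had at least k p transitions, two of the states s₀, s_p, …, s_{kp} would
-- coincide, giving a loop W of m p transitions in the prefix; let C be m turns of the cycle in the
-- interior.  Replacing W by C, or C by W, gives sequences whose probabilities multiply to Pr[s]², so
-- both tie with s and W and C have equal probability for every chain of the region.  If W and C have
-- the same transitions, replacing W by C is a rearrangement with a longer interior, against maximality.
-- Otherwise cancel common transitions and let e = (i , j) be left in C.  Since C follows a cycle, it
-- has no other transition out of i, while e is no longer in W; so the tie is strictly monotone when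
-- mass moves in row i between j and the last column.  As the transitions used have probability bounded
-- below (s beats the greedy path), the tie locus is, uniformly at scale h, a graph over the other
-- coordinates, and a grid of mesh h covers it with volume O(h): the region is null.  All estimates are
-- made on rational approximations of the chains.  The suffix is symmetric.

module Submission where

open import Defs
import Algebra.Solver.CommutativeMonoid as CommutativeMonoidSolver
open import Data.Fin.Base using (Fin; zero; suc; toℕ; inject₁; fromℕ)
import Data.Fin.Properties as Finₚ
open import Data.Fin.Relation.Unary.Top using (view; ‵fromℕ; ‵inject₁)
import Data.Integer.Base as ℤ
import Data.Integer.Properties as ℤₚ
open import Data.List.Base using (List; []; _∷_; [_]; _++_; length; map; tabulate; upTo; cartesianProductWith)
open import Data.List.Membership.Propositional using (_∈_; _∉_)
import Data.List.Membership.DecPropositional as DecMembership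
open import Data.List.Membership.Propositional.Properties using (∈-∃++; ∈-++⁺ˡ; ∈-++⁺ʳ; ∈-tabulate⁻; ∈-upTo⁺; ∈-cartesianProductWith⁺)
open import Data.List.Properties using (length-++; length-map; length-upTo; length-tabulate; tabulate-cong; ++-assoc; ∷-injectiveˡ; ∷-injectiveʳ)
open import Data.List.Relation.Binary.Permutation.Propositional using (_↭_; ↭-refl; ↭-sym; ↭-trans; ↭-reflexive)
import Data.List.Relation.Binary.Permutation.Propositional as Perm
open import Data.List.Relation.Binary.Permutation.Propositional.Properties using (shift; ∈-resp-↭; ↭-length; ++⁺; ++⁺ˡ; ++⁺ʳ; ++-comm; ++-commutativeMonoid)
open import Data.List.Relation.Unary.All using (All; []; _∷_)
import Data.List.Relation.Unary.All as All
import Data.List.Relation.Unary.All.Properties as Allₚ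
open import Data.List.Relation.Unary.Any using (here; there)
open import Data.Maybe.Base using (just; nothing; maybe)
import Data.Maybe.Relation.Unary.Any as Maybe
import Data.Nat.Coprimality as Coprimality
open import Data.Product.Base using (∃-syntax; Σ-syntax; _×_; _,_; proj₁; proj₂)
open import Data.Product.Properties using (≡-dec)
open import Data.Vec.Base using (Vec; []; _∷_)
import Data.Vec.Base as Vec
open import Data.Vec.Functional using (foldr)
open import Data.Vec.Properties using (lookup∘tabulate)
open import Function.Base using (_∘_)
open import Function.Bundles using (module Equivalence)
open import Function.Definitions using (Injective)
open import Relation.Binary.Definitions using (DecidableEquality)
open import Relation.Binary.PropositionalEquality using (_≡_; _≢_; refl; sym; trans; cong; cong₂; subst; subst₂; module ≡-Reasoning)
open import Relation.Nullary using (¬_; Dec; yes; no; contradiction)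
open import Relation.Nullary.Decidable using (_×-dec_; ¬¬-excluded-middle)

-- The order of these reals is undecidable, so a tie is not solved for one coordinate. Two near-ties
-- are compared instead: if they agree up to h in all other coordinates and differ much in one, the
-- balance of C against W shifts too far for both to be ties. The lower bound on the used
-- transitions makes this uniform: an additive error h becomes a relative error of order h, and
-- relative errors accumulate over boundedly many factors. So the constant K is the same at every
-- scale h, which a cover of volume O(h) requires.
--
-- Each row has a fixed sum, so raising one coordinate lowers the dropped last entry, which the
-- products may use as well. One of these two entries is e. The other is absent from C because a
-- cycle has one transition out of each state; in W it can only sharpen the imbalance.
--
-- In dimension 0 a point has positive measure, so the argument must exclude a single state. W and C
-- have equal length, so cancellation that leaves e in C also leaves in W a transition different
-- from e.

module _ where

  open import Data.Nat.Base using (ℕ; zero; suc)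
  import Data.Nat.Base as ℕ
  import Data.Nat.Properties as ℕₚ
  open import Data.Rational.Base using (ℚ; mkℚ; 0ℚ; 1ℚ; ½; _+_; _*_; _-_; -_; _≤_; _<_; 1/_; ∣_∣)
  import Data.Rational.Base as ℚ
  open import Data.Rational.Properties
  open import Data.Rational.Solver using (module +-*-Solver)
  import Data.Rational.Unnormalised.Base as ℚᵘ
  import Data.Rational.Unnormalised.Properties as ℚᵘₚ
  open +-*-Solver using (solve; _:=_; _:+_; _:*_; _:-_; :-_; con)

  private
    variable
      A : Set

  -- Rational arithmetic

  -- The slack `z` is a certificate: an inequality reduces to a polynomial identity for the ring
  -- solver and to the sign of `z`.
  ≤-by : ∀ {x y} z → 0ℚ ≤ z → y ≡ x + z → x ≤ y
  ≤-by {x} z 0≤z refl = ≤-trans (≤-reflexive (sym (+-identityʳ x))) (+-monoʳ-≤ x 0≤z)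

  ≤⇒0≤- : ∀ {x y} → x ≤ y → 0ℚ ≤ y - x
  ≤⇒0≤- {x} {y} x≤y = ≤-trans (≤-reflexive (sym (+-inverseʳ x))) (+-monoˡ-≤ (- x) x≤y)

  0≤+ : ∀ {x y} → 0ℚ ≤ x → 0ℚ ≤ y → 0ℚ ≤ x + y
  0≤+ = +-mono-≤

  0≤* : ∀ {x y} → 0ℚ ≤ x → 0ℚ ≤ y → 0ℚ ≤ x * y
  0≤* {x} {y} 0≤x 0≤y = nonNegative⁻¹ (x * y)
    {{nonNeg*nonNeg⇒nonNeg x {{ℚ.nonNegative 0≤x}} y {{ℚ.nonNegative 0≤y}}}}

  0<* : ∀ {x y} → 0ℚ < x → 0ℚ < y → 0ℚ < x * y
  0<* {x} {y} 0<x 0<y = positive⁻¹ (x * y) {{pos*pos⇒pos x {{ℚ.positive 0<x}} y {{ℚ.positive 0<y}}}}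

  *-monoˡ : ∀ {c x y} → 0ℚ ≤ c → x ≤ y → c * x ≤ c * y
  *-monoˡ {c} 0≤c = *-monoˡ-≤-nonNeg c {{ℚ.nonNegative 0≤c}}

  *-monoʳ : ∀ {c x y} → 0ℚ ≤ c → x ≤ y → x * c ≤ y * c
  *-monoʳ {c} 0≤c = *-monoʳ-≤-nonNeg c {{ℚ.nonNegative 0≤c}}

  *-mono : ∀ {x y u v} → 0ℚ ≤ x → 0ℚ ≤ v → x ≤ y → u ≤ v → x * u ≤ y * v
  *-mono 0≤x 0≤v x≤y u≤v = ≤-trans (*-monoˡ 0≤x u≤v) (*-monoʳ 0≤v x≤y)

  *-cancelˡ : ∀ {c x y} → 0ℚ < c → c * x ≤ c * y → x ≤ y
  *-cancelˡ {c} 0<c = *-cancelˡ-≤-pos c {{ℚ.positive 0<c}}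

  0≤1 : 0ℚ ≤ 1ℚ
  0≤1 = nonNegative⁻¹ 1ℚ

  0<1 : 0ℚ < 1ℚ
  0<1 = positive⁻¹ 1ℚ

  two : ℚ
  two = 1ℚ + 1ℚ

  0<two : 0ℚ < two
  0<two = positive⁻¹ two

  reciprocal : ∀ {x} → 0ℚ < x → ∃[ y ] (0ℚ < y × x * y ≡ 1ℚ)
  reciprocal {x} 0<x = (1/ x) , positive⁻¹ (1/ x) {{1/pos⇒pos x}} , *-inverseʳ x
    where
    instance
      x⁺ : ℚ.Positive x
      x⁺ = ℚ.positive 0<x
      x≢0 : ℚ.NonZero x
      x≢0 = pos⇒nonZero x

  0<min : ∀ {x y} → 0ℚ < x → 0ℚ < y → ∃[ z ] (0ℚ < z × z ≤ x × z ≤ y)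
  0<min {x} {y} 0<x 0<y with x ≤? y
  ... | yes x≤y = x , 0<x , ≤-refl , x≤y
  ... | no  x≰y = y , 0<y , <⇒≤ (≰⇒> x≰y) , ≤-refl

  fromNat : ℕ → ℚ
  fromNat zero    = 0ℚ
  fromNat (suc n) = 1ℚ + fromNat n

  0≤fromNat : ∀ n → 0ℚ ≤ fromNat n
  0≤fromNat zero    = ≤-refl
  0≤fromNat (suc n) = 0≤+ 0≤1 (0≤fromNat n)

  0<fromNat : ∀ n → 0ℚ < fromNat (suc n)
  0<fromNat n = +-mono-<-≤ 0<1 (0≤fromNat n)

  fromNat-+ : ∀ m n → fromNat (m ℕ.+ n) ≡ fromNat m + fromNat n
  fromNat-+ zero    n = sym (+-identityˡ (fromNat n))
  fromNat-+ (suc m) n = trans (cong (1ℚ +_) (fromNat-+ m n)) (sym (+-assoc 1ℚ (fromNat m) (fromNat n)))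

  fromNat-* : ∀ m n → fromNat (m ℕ.* n) ≡ fromNat m * fromNat n
  fromNat-* zero    n = sym (*-zeroˡ (fromNat n))
  fromNat-* (suc m) n = trans (fromNat-+ n (m ℕ.* n)) (trans (cong (fromNat n +_) (fromNat-* m n))
    (solve 2 (λ x y → y :+ x :* y := (con 1ℚ :+ x) :* y) refl (fromNat m) (fromNat n)))

  archimedean : ∀ x → ∃[ n ] (x ≤ fromNat (suc n))
  archimedean x@(mkℚ i d _) = ℤ.∣ i ∣ , ≤-trans x≤ι (≤-trans (≤-reflexive (ι≡fromNat ℤ.∣ i ∣))
      (≤-by 1ℚ 0≤1 (+-comm 1ℚ (fromNat ℤ.∣ i ∣))))
    where
    ι : ℕ → ℚ
    ι n = mkℚ (ℤ.+ n) 0 (Coprimality.sym (Coprimality.1-coprimeTo n))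
    ι-suc : ∀ n → ι (suc n) ≡ 1ℚ + ι n
    ι-suc n = toℚᵘ-injective (ℚᵘₚ.≃-sym (ℚᵘₚ.≃-trans (toℚᵘ-homo-+ 1ℚ (ι n))
      (ℚᵘ.*≡* (cong (λ z → (ℤ.+ 1 ℤ.+ z) ℤ.* ℤ.+ 1) (ℤₚ.*-identityʳ (ℤ.+ n))))))
    ι≡fromNat : ∀ n → ι n ≡ fromNat n
    ι≡fromNat zero    = refl
    ι≡fromNat (suc n) = trans (ι-suc n) (cong (1ℚ +_) (ι≡fromNat n))
    i≤∣i∣ : ∀ i → i ℤ.≤ ℤ.+ ℤ.∣ i ∣
    i≤∣i∣ (ℤ.+ n)      = ℤₚ.≤-refl
    i≤∣i∣ (ℤ.-[1+ n ]) = ℤ.-≤+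
    x≤ι : x ≤ ι ℤ.∣ i ∣
    x≤ι = ℚ.*≤* (ℤₚ.≤-trans (ℤₚ.≤-reflexive (ℤₚ.*-identityʳ i)) (ℤₚ.≤-trans (i≤∣i∣ i)
      (ℤₚ.≤-trans (ℤ.+≤+ (ℕₚ.m≤m*n ℤ.∣ i ∣ (suc d))) (ℤₚ.≤-reflexive (ℤₚ.pos-* ℤ.∣ i ∣ (suc d))))))

  infixr 8 _^_

  _^_ : ℚ → ℕ → ℚ
  x ^ zero  = 1ℚ
  x ^ suc n = x * x ^ n

  0<^ : ∀ {x} n → 0ℚ < x → 0ℚ < x ^ n
  0<^ zero    0<x = 0<1
  0<^ (suc n) 0<x = 0<* 0<x (0<^ n 0<x)

  0≤^ : ∀ {x} n → 0ℚ ≤ x → 0ℚ ≤ x ^ n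
  0≤^ zero    0≤x = 0≤1
  0≤^ (suc n) 0≤x = 0≤* 0≤x (0≤^ n 0≤x)

  ^-+ : ∀ x m n → x ^ (m ℕ.+ n) ≡ x ^ m * x ^ n
  ^-+ x zero    n = sym (*-identityˡ (x ^ n))
  ^-+ x (suc m) n = trans (cong (x *_) (^-+ x m n)) (sym (*-assoc x (x ^ m) (x ^ n)))

  1≤two : 1ℚ ≤ two
  1≤two = ≤-by {1ℚ} 1ℚ 0≤1 refl

  1≤2^ : ∀ n → 1ℚ ≤ two ^ n
  1≤2^ zero    = ≤-refl
  1≤2^ (suc n) = *-mono 0≤1 (≤-trans 0≤1 (1≤2^ n)) 1≤two (1≤2^ n)

  -- By convexity the power lies below its chord over [0, 1]. This makes an accumulated relative
  -- error linear in `x`.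
  [1+x]^n≤1+[2^n-1]x : ∀ {x} n → 0ℚ ≤ x → x ≤ 1ℚ → (1ℚ + x) ^ n ≤ 1ℚ + (two ^ n - 1ℚ) * x
  [1+x]^n≤1+[2^n-1]x {x} zero    0≤x x≤1 =
    ≤-reflexive (solve 1 (λ x → con 1ℚ := con 1ℚ :+ (con 1ℚ :- con 1ℚ) :* x) refl x)
  [1+x]^n≤1+[2^n-1]x {x} (suc n) 0≤x x≤1 = ≤-trans
    (*-monoˡ (0≤+ 0≤1 0≤x) ([1+x]^n≤1+[2^n-1]x n 0≤x x≤1))
    (≤-by ((T - 1ℚ) * x * (1ℚ - x)) (0≤* (0≤* (≤⇒0≤- (1≤2^ n)) 0≤x) (≤⇒0≤- x≤1))
      (solve 2 (λ x T → con 1ℚ :+ ((con 1ℚ :+ con 1ℚ) :* T :- con 1ℚ) :* x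
          := (con 1ℚ :+ x) :* (con 1ℚ :+ (T :- con 1ℚ) :* x) :+ (T :- con 1ℚ) :* x :* (con 1ℚ :- x)) refl x T))
    where
    T : ℚ
    T = two ^ n

  ∑ᵠ ∏ᵠ : ∀ {n} → (Fin n → ℚ) → ℚ
  ∑ᵠ = foldr _+_ 0ℚ
  ∏ᵠ = foldr _*_ 1ℚ

  ∑-≤ : ∀ {n c} (f : Fin n → ℚ) → (∀ i → f i ≤ c) → ∑ᵠ f ≤ fromNat n * c
  ∑-≤ {zero}  {c} f f≤ = ≤-reflexive (sym (*-zeroˡ c))
  ∑-≤ {suc n} {c} f f≤ = ≤-trans (+-mono-≤ (f≤ zero) (∑-≤ (f ∘ suc) (f≤ ∘ suc)))
    (≤-reflexive (solve 2 (λ n c → c :+ n :* c := (con 1ℚ :+ n) :* c) refl (fromNat n) c))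

  ∑-mono-+ : ∀ {n h} (f g : Fin n → ℚ) → (∀ i → f i ≤ g i + h) → ∑ᵠ f ≤ ∑ᵠ g + fromNat n * h
  ∑-mono-+ {zero}  {h} f g f≤g = ≤-reflexive (solve 1 (λ h → con 0ℚ := con 0ℚ :+ con 0ℚ :* h) refl h)
  ∑-mono-+ {suc n} {h} f g f≤g =
    ≤-trans (+-mono-≤ (f≤g zero) (∑-mono-+ (f ∘ suc) (g ∘ suc) (f≤g ∘ suc)))
    (≤-reflexive (solve 4 (λ a h b n → (a :+ h) :+ (b :+ n :* h) := (a :+ b) :+ (con 1ℚ :+ n) :* h)
      refl (g zero) h (∑ᵠ (g ∘ suc)) (fromNat n)))

  ∑-mono-at : ∀ {n h c} (f g : Fin n → ℚ) i → 0ℚ ≤ h → (∀ j → j ≢ i → f j ≤ g j + h) →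
    f i + c ≤ g i → ∑ᵠ f + c ≤ ∑ᵠ g + fromNat n * h
  ∑-mono-at {suc n} {h} {c} f g zero 0≤h f≤g f+c≤g = ≤-trans
    (≤-trans (≤-reflexive (solve 3 (λ a b c → a :+ b :+ c := (a :+ c) :+ b) refl (f zero) (∑ᵠ (f ∘ suc)) c))
      (+-mono-≤ f+c≤g (∑-mono-+ (f ∘ suc) (g ∘ suc) (λ j → f≤g (suc j) λ ()))))
    (≤-by h 0≤h (solve 4 (λ a h b n → (a :+ b) :+ (con 1ℚ :+ n) :* h := (a :+ (b :+ n :* h)) :+ h)
      refl (g zero) h (∑ᵠ (g ∘ suc)) (fromNat n)))
  ∑-mono-at {suc n} {h} {c} f g (suc i) 0≤h f≤g f+c≤g = ≤-trans
    (≤-trans (≤-reflexive (+-assoc (f zero) (∑ᵠ (f ∘ suc)) c))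
      (+-mono-≤ (f≤g zero λ ())
        (∑-mono-at (f ∘ suc) (g ∘ suc) i 0≤h (λ j j≢i → f≤g (suc j) λ { refl → j≢i refl }) f+c≤g)))
    (≤-reflexive (solve 4 (λ a h b n → (a :+ h) :+ (b :+ n :* h) := (a :+ b) :+ (con 1ℚ :+ n) :* h)
      refl (g zero) h (∑ᵠ (g ∘ suc)) (fromNat n)))

  ∑-0 : ∀ n → ∑ᵠ {n} (λ _ → 0ℚ) ≡ 0ℚ
  ∑-0 zero    = refl
  ∑-0 (suc n) = trans (+-identityˡ _) (∑-0 n)

  -- Compare `f` with the zero vector, whose entry at `i` has to rise by `f i`.
  entry≤∑ : ∀ {n h} (f : Fin n → ℚ) i → 0ℚ ≤ h → (∀ j → - h ≤ f j) → f i ≤ ∑ᵠ f + fromNat n * h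
  entry≤∑ {n} {h} f i 0≤h -h≤f = subst (_≤ ∑ᵠ f + fromNat n * h)
    (trans (cong (_+ f i) (∑-0 n)) (+-identityˡ (f i)))
    (∑-mono-at (λ _ → 0ℚ) f i 0≤h
      (λ j _ → ≤-trans (≤-reflexive (sym (+-inverseˡ h))) (+-monoˡ-≤ h (-h≤f j)))
      (≤-reflexive (+-identityˡ (f i))))

  ∑-last : ∀ {n} (f : Fin (suc n) → ℚ) → ∑ᵠ f ≡ ∑ᵠ (f ∘ inject₁) + f (fromℕ n)
  ∑-last {zero}  f = trans (+-comm (f zero) 0ℚ) refl
  ∑-last {suc n} f = trans (cong (f zero +_) (∑-last (f ∘ suc)))
    (sym (+-assoc (f zero) (∑ᵠ (f ∘ suc ∘ inject₁)) (f (fromℕ (suc n)))))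

  large-entry : ∀ {n c} (f : Fin n → ℚ) → fromNat n * c < ∑ᵠ f → ∃[ i ] (c ≤ f i)
  large-entry {n} {c} f nc<∑ with Finₚ.¬∀⟶∃¬ n (λ i → f i ≤ c) (λ i → f i ≤? c)
    (λ f≤c → <-irrefl refl (<-≤-trans nc<∑ (∑-≤ f f≤c)))
  ... | i , fi≰c = i , <⇒≤ (≰⇒> fi≰c)

  0≤∏ : ∀ {n} (f : Fin n → ℚ) → (∀ i → 0ℚ ≤ f i) → 0ℚ ≤ ∏ᵠ f
  0≤∏ {zero}  f 0≤f = 0≤1
  0≤∏ {suc n} f 0≤f = 0≤* (0≤f zero) (0≤∏ (f ∘ suc) (0≤f ∘ suc))

  ∏-cong : ∀ {n} {f g : Fin n → ℚ} → (∀ i → f i ≡ g i) → ∏ᵠ f ≡ ∏ᵠ g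
  ∏-cong {zero}  f≡g = refl
  ∏-cong {suc n} f≡g = cong₂ _*_ (f≡g zero) (∏-cong (f≡g ∘ suc))

  ∏-* : ∀ {n} (f g : Fin n → ℚ) → ∏ᵠ (λ i → f i * g i) ≡ ∏ᵠ f * ∏ᵠ g
  ∏-* {zero}  f g = refl
  ∏-* {suc n} f g = trans (cong (f zero * g zero *_) (∏-* (f ∘ suc) (g ∘ suc)))
    (solve 4 (λ a b c d → a :* b :* (c :* d) := a :* c :* (b :* d)) refl
      (f zero) (g zero) (∏ᵠ (f ∘ suc)) (∏ᵠ (g ∘ suc)))

  ∏-≤-^ : ∀ {n c} (f : Fin n → ℚ) → (∀ i → 0ℚ ≤ f i) → (∀ i → f i ≤ c) → ∏ᵠ f ≤ c ^ n
  ∏-≤-^ {zero}  f 0≤f f≤c = ≤-refl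
  ∏-≤-^ {suc n} f 0≤f f≤c = *-mono (0≤f zero) (0≤^ n (≤-trans (0≤f zero) (f≤c zero)))
    (f≤c zero) (∏-≤-^ (f ∘ suc) (0≤f ∘ suc) (f≤c ∘ suc))

  -- The factor at `i` will be the only small one. As `1 ≤ c`, a spare factor `c` may be added,
  -- which avoids the exponent n - 1.
  ∏-≤-at : ∀ {n c κ} (f : Fin n → ℚ) i → 1ℚ ≤ c → (∀ j → 0ℚ ≤ f j) → (∀ j → j ≢ i → f j ≤ c) → f i ≤ κ →
    ∏ᵠ f ≤ κ * c ^ n
  ∏-≤-at {suc n} {c} {κ} f zero 1≤c 0≤f f≤c fi≤κ = ≤-trans
    (*-mono (0≤f zero) (0≤^ n 0≤c) fi≤κ (∏-≤-^ (f ∘ suc) (0≤f ∘ suc) (λ j → f≤c (suc j) λ ())))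
    (*-monoˡ (≤-trans (0≤f zero) fi≤κ)
      (≤-trans (≤-reflexive (sym (*-identityˡ (c ^ n)))) (*-monoʳ (0≤^ n 0≤c) 1≤c)))
    where
    0≤c : 0ℚ ≤ c
    0≤c = ≤-trans 0≤1 1≤c
  ∏-≤-at {suc n} {c} {κ} f (suc i) 1≤c 0≤f f≤c fi≤κ = ≤-trans
    (*-mono (0≤f zero) (0≤* (≤-trans (0≤f (suc i)) fi≤κ) (0≤^ n 0≤c)) (f≤c zero λ ())
      (∏-≤-at (f ∘ suc) i 1≤c (0≤f ∘ suc) (λ j j≢i → f≤c (suc j) λ { refl → j≢i refl }) fi≤κ))
    (≤-reflexive (solve 3 (λ c κ d → c :* (κ :* d) := κ :* (c :* d)) refl c κ (c ^ n)))
    where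
    0≤c : 0ℚ ≤ c
    0≤c = ≤-trans 0≤1 1≤c

  -- Products over lists of transitions

  weight : (A → ℚ) → List A → ℚ
  weight w []       = 1ℚ
  weight w (x ∷ xs) = w x * weight w xs

  weight-++ : ∀ (w : A → ℚ) xs ys → weight w (xs ++ ys) ≡ weight w xs * weight w ys
  weight-++ w []       ys = sym (*-identityˡ (weight w ys))
  weight-++ w (x ∷ xs) ys = trans (cong (w x *_) (weight-++ w xs ys)) (sym (*-assoc (w x) (weight w xs) (weight w ys)))

  weight-↭ : ∀ (w : A → ℚ) {xs ys} → xs ↭ ys → weight w xs ≡ weight w ys
  weight-↭ w Perm.refl        = refl
  weight-↭ w (Perm.prep x p)  = cong (w x *_) (weight-↭ w p)
  weight-↭ w (Perm.swap {ys = ys} x y p) = trans (cong (λ z → w x * (w y * z)) (weight-↭ w p))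
    (solve 3 (λ a b c → a :* (b :* c) := b :* (a :* c)) refl (w x) (w y) (weight w ys))
  weight-↭ w (Perm.trans p q) = trans (weight-↭ w p) (weight-↭ w q)

  0<weight : ∀ (w : A → ℚ) xs → (∀ {x} → x ∈ xs → 0ℚ < w x) → 0ℚ < weight w xs
  0<weight w []       0<w = 0<1
  0<weight w (x ∷ xs) 0<w = 0<* (0<w (here refl)) (0<weight w xs (0<w ∘ there))

  weight-scale : ∀ (w v : A → ℚ) {c} xs → 0ℚ ≤ c → (∀ {x} → x ∈ xs → 0ℚ ≤ w x × w x ≤ c * v x) →
    0ℚ ≤ weight w xs × weight w xs ≤ c ^ length xs * weight v xs
  weight-scale w v []       0≤c w≤cv = 0≤1 , ≤-reflexive (sym (*-identityˡ 1ℚ))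
  weight-scale w v {c} (x ∷ xs) 0≤c w≤cv with w≤cv (here refl) | weight-scale w v xs 0≤c (w≤cv ∘ there)
  ... | 0≤wx , wx≤ | 0≤ws , ws≤ = 0≤* 0≤wx 0≤ws ,
    ≤-trans (*-mono 0≤wx (≤-trans 0≤ws ws≤) wx≤ ws≤)
      (≤-reflexive (solve 4 (λ c d a b → (c :* a) :* (d :* b) := (c :* d) :* (a :* b)) refl
        c (c ^ length xs) (v x) (weight v xs)))

  -- The hypotheses are one-sided: from w₁ to w₂ the elements of W may drop and those of C grow freely.
  balanced-close : ∀ (w₁ w₂ : A → ℚ) {c} W e C → 0ℚ ≤ c →
    (∀ {x} → x ∈ W → 0ℚ < w₁ x × 0ℚ < w₂ x × w₂ x ≤ c * w₁ x) →
    (∀ {x} → x ∈ C → 0ℚ < w₁ x × 0ℚ < w₂ x × w₁ x ≤ c * w₂ x) → 0ℚ < w₁ e →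
    weight w₁ W ≤ c * weight w₁ (e ∷ C) → weight w₂ (e ∷ C) ≤ c * weight w₂ W →
    w₂ e ≤ c ^ suc (suc (length W ℕ.+ length C)) * w₁ e
  balanced-close w₁ w₂ {c} W e C 0≤c onW onC 0<e bal₁ bal₂ =
    -- Each element of `W` and of `C` costs one factor `c`, and so does each of the two ties; hence
    -- the exponent.
    *-cancelˡ (0<weight w₂ C (proj₁ ∘ proj₂ ∘ onC)) (begin
      C₂ * w₂ e                     ≡⟨ *-comm C₂ (w₂ e) ⟩
      w₂ e * C₂                     ≤⟨ bal₂ ⟩
      c * W₂                        ≤⟨ *-monoˡ 0≤c (proj₂ (weight-scale w₂ w₁ W 0≤c λ x∈ → <⇒≤ (proj₁ (proj₂ (onW x∈))) , proj₂ (proj₂ (onW x∈)))) ⟩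
      c * (cʷ * W₁)                 ≤⟨ *-monoˡ 0≤c (*-monoˡ (0≤^ (length W) 0≤c) bal₁) ⟩
      c * (cʷ * (c * (w₁ e * C₁)))  ≤⟨ *-monoˡ 0≤c (*-monoˡ (0≤^ (length W) 0≤c) (*-monoˡ 0≤c (*-monoˡ (<⇒≤ 0<e)
                                         (proj₂ (weight-scale w₁ w₂ C 0≤c λ x∈ → <⇒≤ (proj₁ (onC x∈)) , proj₂ (proj₂ (onC x∈))))))) ⟩
      c * (cʷ * (c * (w₁ e * (cᶜ * C₂))))  ≡⟨ solve 5 (λ c d a f b → c :* (d :* (c :* (a :* (f :* b)))) := b :* (c :* (c :* (d :* f)) :* a)) refl c cʷ (w₁ e) cᶜ C₂ ⟩
      C₂ * (c * (c * (cʷ * cᶜ)) * w₁ e)    ≡⟨ cong (λ z → C₂ * (c * (c * z) * w₁ e)) (sym (^-+ c (length W) (length C))) ⟩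
      C₂ * (c ^ suc (suc (length W ℕ.+ length C)) * w₁ e) ∎)
    where
    open ≤-Reasoning
    C₁ C₂ W₁ W₂ cʷ cᶜ : ℚ
    C₁ = weight w₁ C
    C₂ = weight w₂ C
    W₁ = weight w₁ W
    W₂ = weight w₂ W
    cʷ = c ^ length W
    cᶜ = c ^ length C

  -- `zs` is the multiset intersection. A later removal from `xs′` cannot spoil the disjointness
  -- already reached.
  cancel-common : DecidableEquality A → ∀ (xs ys : List A) →
    ∃[ zs ] ∃[ xs′ ] ∃[ ys′ ] (xs ↭ zs ++ xs′ × ys ↭ zs ++ ys′ × (∀ {y} → y ∈ ys′ → y ∉ xs′))
  cancel-common _≟_ xs [] = [] , xs , [] , ↭-refl , ↭-refl , λ ()
  cancel-common {A} _≟_ xs (y ∷ ys) with cancel-common _≟_ xs ys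
  ... | zs , xs′ , ys′ , xs↭ , ys↭ , disj with y ∈? xs′
    where open DecMembership _≟_ using (_∈?_)
  ... | no y∉ = zs , xs′ , y ∷ ys′ , xs↭ , ↭-trans (Perm.prep y ys↭) (↭-sym (shift y zs ys′)) , λ
    { (here refl) → y∉
    ; (there z∈)  → disj z∈ }
  ... | yes y∈ with ∈-∃++ y∈
  ... | us , vs , refl = y ∷ zs , us ++ vs , ys′ ,
    ↭-trans xs↭ (↭-trans (++⁺ˡ zs (shift y us vs)) (shift y zs (us ++ vs))) ,
    Perm.prep y ys↭ ,
    λ z∈ z∈′ → disj z∈ (∈-resp-↭ (↭-sym (shift y us vs)) (there z∈′))

  -- Null sets

  -- The product of the `f i`. Its elements are vectors rather than functions, since membership is
  -- stated by propositional equality.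
  choices : ∀ {n} → (Fin n → List A) → List (Vec A n)
  choices {n = zero}  f = [ [] ]
  choices {n = suc n} f = cartesianProductWith _∷_ (f zero) (choices (f ∘ suc))

  tabulate∈choices : ∀ {n} (f : Fin n → List A) (g : Fin n → A) → (∀ i → g i ∈ f i) → Vec.tabulate g ∈ choices f
  tabulate∈choices {n = zero}  f g g∈f = here refl
  tabulate∈choices {n = suc n} f g g∈f = ∈-cartesianProductWith⁺ _∷_ (g∈f zero)
    (tabulate∈choices (f ∘ suc) (g ∘ suc) (g∈f ∘ suc))

  length-cartesianProductWith : ∀ {B C : Set} (f : A → B → C) xs ys →
    length (cartesianProductWith f xs ys) ≡ length xs ℕ.* length ys
  length-cartesianProductWith f []       ys = refl
  length-cartesianProductWith f (x ∷ xs) ys = trans (length-++ (map (f x) ys))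
    (cong₂ ℕ._+_ (length-map (f x) ys) (length-cartesianProductWith f xs ys))

  length-choices : ∀ {n} (f : Fin n → List A) → fromNat (length (choices f)) ≡ ∏ᵠ (fromNat ∘ length ∘ f)
  length-choices {n = zero}  f = refl
  length-choices {n = suc n} f = trans (cong fromNat (length-cartesianProductWith _∷_ (f zero) (choices (f ∘ suc))))
    (trans (fromNat-* (length (f zero)) (length (choices (f ∘ suc))))
      (cong (fromNat (length (f zero)) *_) (length-choices (f ∘ suc))))

  cell : ∀ {h} → 0ℚ ≤ h → ∀ m x → 0ℚ ≤ x → x ≤ fromNat (suc m) * h →
    ∃[ g ] (g ℕ.< suc m × fromNat g * h ≤ x × x ≤ fromNat (suc g) * h)
  cell {h} 0≤h zero x 0≤x x≤ = 0 , ℕ.s≤s ℕ.z≤n , ≤-trans (≤-reflexive (*-zeroˡ h)) 0≤x , x≤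
  cell {h} 0≤h (suc m) x 0≤x x≤ with x ≤? fromNat (suc m) * h
  ... | no  x≰  = suc m , ℕₚ.≤-refl , <⇒≤ (≰⇒> x≰) , x≤
  ... | yes x≤′ with cell 0≤h m x 0≤x x≤′
  ... | g , g< , lo , hi = g , ℕₚ.m≤n⇒m≤1+n g< , lo , hi

  -- Excluded middle holds under double negation, and over a finite list its instances can be
  -- collected one by one.
  ¬¬-All-Dec : ∀ (P : A → Set) xs → ¬ ¬ All (λ x → Dec (P x)) xs
  ¬¬-All-Dec P []       k = k []
  ¬¬-All-Dec P (x ∷ xs) k = ¬¬-excluded-middle λ d → ¬¬-All-Dec P xs λ ds → k (d ∷ ds)

  fromNat-mono : ∀ {m n} → m ℕ.≤ n → fromNat m ≤ fromNat n
  fromNat-mono {n = n} ℕ.z≤n = 0≤fromNat n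
  fromNat-mono (ℕ.s≤s m≤n) = +-monoʳ-≤ 1ℚ (fromNat-mono m≤n)

  listFamily : ∀ {r c} → List (Box r c) → BoxFamily r c
  listFamily []       _       = nothing
  listFamily (b ∷ bs) zero    = just b
  listFamily (b ∷ bs) (suc i) = listFamily bs i

  partialVolume-suc : ∀ {r c} (B : BoxFamily r c) N →
    partialVolume B (suc N) ≡ maybe volume 0ℚ (B 0) + partialVolume (B ∘ suc) N
  partialVolume-suc B zero    = +-comm 0ℚ (maybe volume 0ℚ (B 0))
  partialVolume-suc B (suc N) = trans (cong (_+ maybe volume 0ℚ (B (suc N))) (partialVolume-suc B N))
    (+-assoc (maybe volume 0ℚ (B 0)) (partialVolume (B ∘ suc) N) (maybe volume 0ℚ (B (suc N))))

  partialVolume-listFamily : ∀ {r c V} (bs : List (Box r c)) → 0ℚ ≤ V → All (λ b → volume b ≤ V) bs →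
    ∀ N → partialVolume (listFamily bs) N ≤ fromNat (length bs) * V
  partialVolume-listFamily {V = V} bs 0≤V _ zero = 0≤* (0≤fromNat (length bs)) 0≤V
  partialVolume-listFamily {V = V} [] 0≤V [] (suc N) = ≤-trans
    (≤-reflexive (+-identityʳ (partialVolume (listFamily []) N))) (partialVolume-listFamily [] 0≤V [] N)
  partialVolume-listFamily {V = V} (b ∷ bs) 0≤V (b≤ ∷ bs≤) (suc N) = ≤-trans
    (≤-reflexive (partialVolume-suc (listFamily (b ∷ bs)) N))
    (≤-trans (+-mono-≤ b≤ (partialVolume-listFamily bs 0≤V bs≤ N))
      (≤-reflexive (solve 2 (λ v n → v :+ n :* v := (con 1ℚ :+ n) :* v) refl V (fromNat (length bs)))))

  fromℚ-≤ᴿ : ∀ {p q x} → p ≤ q → fromℚ q ≤ᴿ x → fromℚ p ≤ᴿ x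
  fromℚ-≤ᴿ p≤q q≤x ε ε>0 with q≤x ε ε>0
  ... | N , q≤ = N , λ n N≤n → ≤-trans p≤q (q≤ n N≤n)

  ≤ᴿ-fromℚ : ∀ {p q x} → p ≤ q → x ≤ᴿ fromℚ p → x ≤ᴿ fromℚ q
  ≤ᴿ-fromℚ p≤q x≤p ε ε>0 with x≤p ε ε>0
  ... | N , ≤p = N , λ n N≤n → ≤-trans (≤p n N≤n) (+-monoˡ-≤ ε p≤q)

  -- h = 1 / (n + 1) with n + 1 at least X / ε + 1 / h₀. As h divides 1, the range [-1, 2] of the
  -- entries is cut into exactly 3 (n + 1) cells.
  mesh : ∀ X {h₀ ε} → 0ℚ ≤ X → 0ℚ < h₀ → 0ℚ < ε →
    ∃[ n ] ∃[ h ] (0ℚ < h × fromNat (suc n) * h ≡ 1ℚ × h ≤ h₀ × X * h ≤ ε)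
  mesh X {h₀} {ε} 0≤X 0<h₀ 0<ε with reciprocal 0<ε | reciprocal 0<h₀
  ... | ε⁻ , 0<ε⁻ , εε⁻≡1 | h₀⁻ , 0<h₀⁻ , h₀h₀⁻≡1 with archimedean (X * ε⁻ + h₀⁻)
  ... | n , n≥ with reciprocal (0<fromNat n)
  ... | h , 0<h , nh≡1 = n , h , 0<h , nh≡1 , h≤h₀ , Xh≤ε
    where
    small : ∀ {y z} → 0ℚ ≤ z → z + y ≤ fromNat (suc n) → y * h ≤ 1ℚ
    small {y} {z} 0≤z ≤n = ≤-trans (*-monoʳ (<⇒≤ 0<h) (≤-trans (≤-by {y} z 0≤z (+-comm z y)) ≤n)) (≤-reflexive nh≡1)
    h≤h₀ : h ≤ h₀
    h≤h₀ = ≤-trans (≤-reflexive (trans (sym (*-identityˡ h))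
        (trans (cong (_* h) (sym h₀h₀⁻≡1)) (*-assoc h₀ h₀⁻ h))))
      (≤-trans (*-monoˡ (<⇒≤ 0<h₀) (small (0≤* 0≤X (<⇒≤ 0<ε⁻)) n≥))
        (≤-reflexive (*-identityʳ h₀)))
    Xh≤ε : X * h ≤ ε
    Xh≤ε = ≤-trans (≤-reflexive (trans (sym (*-identityˡ (X * h)))
        (trans (cong (_* (X * h)) (sym εε⁻≡1))
          (solve 4 (λ e f x h → e :* f :* (x :* h) := e :* (x :* f :* h)) refl ε ε⁻ X h))))
      (≤-trans (*-monoˡ (<⇒≤ 0<ε) (small (<⇒≤ 0<h₀⁻) (≤-trans (≤-reflexive (+-comm h₀⁻ (X * ε⁻))) n≥)))
        (≤-reflexive (*-identityʳ ε)))

  Close : ∀ {r c} → ℚ → ℝ^ r c → (Fin r → Fin c → ℚ) → Set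
  Close h x q = ∀ i j → fromℚ (q i j - h) ≤ᴿ x i j × x i j ≤ᴿ fromℚ (q i j + h)

  -- The scale-h rational approximations of the points of S: the coordinate (i₀ , j₀) is determined up
  -- to K h by the others up to h, as for a graph over the remaining coordinates.
  record Approximation {r c} (S : ℝ^ r c → Set) (i₀ : Fin r) (j₀ : Fin c) (K h : ℚ) : Set₁ where
    field
      Near    : (Fin r → Fin c → ℚ) → Set
      approx  : ∀ x → S x → ¬ ¬ (∃[ q ] (Near q × Close h x q))
      bounded : ∀ q → Near q → ∀ i j → - 1ℚ ≤ q i j × q i j ≤ two
      graph   : ∀ q q′ → Near q → Near q′ →
                (∀ i j → ¬ (i ≡ i₀ × j ≡ j₀) → q i j ≤ q′ i j + h × q′ i j ≤ q i j + h) →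
                q i₀ j₀ ≤ q′ i₀ j₀ + K * h

  module _ {r c : ℕ} (S : ℝ^ r c → Set) (i₀ : Fin r) (j₀ : Fin c) (K : ℚ) (0≤K : 0ℚ ≤ K) where

    private
      -- An ordinary coordinate has 3 / h cells, each widened to 3 h, and so contributes `nine`. The
      -- special coordinate contributes a single interval of width 2 (K + 1) h.
      three nine : ℚ
      three = 1ℚ + two
      nine  = three * three

      -- The total volume of the cover below is at most scaleFactor times the mesh.
      scaleFactor : ℚ
      scaleFactor = two * (K + 1ℚ) * nine ^ c * (nine ^ c) ^ r

    -- The grid divides every coordinate except (i₀ , j₀), so its cells are columns. By `graph`, one
    -- box around a single approximation in a column contains all points of S approximated in that
    -- column.
    module Cover (n : ℕ) (h : ℚ) (0<h : 0ℚ < h) (nh≡1 : fromNat (suc n) * h ≡ 1ℚ)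
      (appr : Approximation S i₀ j₀ K h) where

      open Approximation appr

      Index : Set
      Index = Vec (Vec ℕ c) r

      Special : Fin r → Fin c → Set
      Special i j = i ≡ i₀ × j ≡ j₀

      special? : ∀ i j → Dec (Special i j)
      special? i j = (i Finₚ.≟ i₀) ×-dec (j Finₚ.≟ j₀)

      at : Index → Fin r → Fin c → ℕ
      at v i j = Vec.lookup (Vec.lookup v i) j

      m : ℕ
      m = suc n ℕ.+ (suc n ℕ.+ suc n)

      mh≡3 : fromNat m * h ≡ three
      mh≡3 = trans (cong (_* h) (trans (fromNat-+ (suc n) (suc n ℕ.+ suc n))
          (cong (fromNat (suc n) +_) (fromNat-+ (suc n) (suc n)))))
        (trans (solve 2 (λ a h → (a :+ (a :+ a)) :* h := a :* h :+ (a :* h :+ a :* h)) refl (fromNat (suc n)) h)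
          (cong (λ z → z + (z + z)) nh≡1))

      -- The dummy cell 0 keeps a column index a full matrix, although the special coordinate is not
      -- divided.
      cells : ∀ {i j} → Dec (Special i j) → List ℕ
      cells (yes _) = [ 0 ]
      cells (no _)  = upTo m

      InColumn : Index → (Fin r → Fin c → ℚ) → Set
      InColumn v q = ∀ i j → ¬ Special i j →
        fromNat (at v i j) * h ≤ q i j + 1ℚ × q i j + 1ℚ ≤ fromNat (suc (at v i j)) * h

      module _ (v : Index) (q : Fin r → Fin c → ℚ) where

        -- The margin `h` is the distance from a point to its approximation; `K * h` is the
        -- distance, in the special coordinate, between two approximations in one column.
        lo hi : ∀ i j → Dec (Special i j) → ℚ
        lo i j (yes _) = q i j - (K * h + h)
        lo i j (no _)  = fromNat (at v i j) * h - 1ℚ - h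
        hi i j (yes _) = q i j + (K * h + h)
        hi i j (no _)  = fromNat (suc (at v i j)) * h - 1ℚ + h

      width : ∀ {i j} → Dec (Special i j) → ℚ
      width (yes _) = two * (K + 1ℚ) * h
      width (no _)  = three * h

      0≤h : 0ℚ ≤ h
      0≤h = <⇒≤ 0<h

      0≤width : ∀ {i j} (d : Dec (Special i j)) → 0ℚ ≤ width d
      0≤width (yes _) = 0≤* (0≤* (0≤+ 0≤1 0≤1) (0≤+ 0≤K 0≤1)) 0≤h
      0≤width (no _)  = 0≤* (0≤+ 0≤1 (0≤+ 0≤1 0≤1)) 0≤h

      hi≡lo+width : ∀ v q i j d → hi v q i j d ≡ lo v q i j d + width d
      hi≡lo+width v q i j (yes _) = solve 3 (λ q K h →
        q :+ (K :* h :+ h) := q :- (K :* h :+ h) :+ (con 1ℚ :+ con 1ℚ) :* (K :+ con 1ℚ) :* h) refl (q i j) K h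
      hi≡lo+width v q i j (no _) = solve 2 (λ a h →
        (con 1ℚ :+ a) :* h :- con 1ℚ :+ h := a :* h :- con 1ℚ :- h :+ (con 1ℚ :+ (con 1ℚ :+ con 1ℚ)) :* h)
        refl (fromNat (at v i j)) h

      box : Index → (Fin r → Fin c → ℚ) → Box r c
      box v q = record
        { lower       = λ i j → lo v q i j (special? i j)
        ; upper       = λ i j → hi v q i j (special? i j)
        ; lower≤upper = λ i j → ≤-by (width (special? i j)) (0≤width (special? i j)) (hi≡lo+width v q i j (special? i j))
        }

      boxVolume : ℚ
      boxVolume = ∏ᵠ λ i → ∏ᵠ λ j → width (special? i j)

      volume-box : ∀ v q → volume (box v q) ≡ boxVolume
      volume-box v q = ∏-cong λ i → ∏-cong λ j → let d = special? i j in
        trans (cong (_- lo v q i j d) (hi≡lo+width v q i j d))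
          (solve 2 (λ a b → a :+ b :- a := b) refl (lo v q i j d) (width d))

      0≤boxVolume : 0ℚ ≤ boxVolume
      0≤boxVolume = 0≤∏ (λ i → ∏ᵠ λ j → width (special? i j))
        λ i → 0≤∏ (λ j → width (special? i j)) λ j → 0≤width (special? i j)

      row : ∀ i → List (Vec ℕ c)
      row i = choices λ j → cells (special? i j)

      columns : List Index
      columns = choices row

      factor : ∀ {i j} → Dec (Special i j) → ℚ
      factor d = fromNat (length (cells d)) * width d

      0≤factor : ∀ {i j} (d : Dec (Special i j)) → 0ℚ ≤ factor d
      0≤factor d = 0≤* (0≤fromNat (length (cells d))) (0≤width d)

      columns-volume : fromNat (length columns) * boxVolume ≡ ∏ᵠ λ i → ∏ᵠ λ j → factor (special? i j)
      columns-volume = trans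
        (cong (_* boxVolume) (trans (length-choices row)
          (∏-cong λ i → length-choices λ j → cells (special? i j))))
        (trans (sym (∏-* (λ i → ∏ᵠ λ j → fromNat (length (cells (special? i j)))) (λ i → ∏ᵠ λ j → width (special? i j))))
          (∏-cong λ i → sym (∏-* (λ j → fromNat (length (cells (special? i j)))) (λ j → width (special? i j)))))

      factor-no : ∀ {i j} (d : Dec (Special i j)) → ¬ Special i j → factor d ≤ nine
      factor-no (yes s) ¬s = contradiction s ¬s
      factor-no (no _)  _  = ≤-reflexive (trans (cong (λ l → fromNat l * (three * h)) (length-upTo m))
        (trans (solve 3 (λ a t h → a :* (t :* h) := a :* h :* t) refl (fromNat m) three h) (cong (_* three) mh≡3)))

      factor-yes : ∀ {i j} (d : Dec (Special i j)) → Special i j → factor d ≤ two * (K + 1ℚ) * h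
      factor-yes (yes _) _ = ≤-reflexive (solve 1 (λ w → (con 1ℚ :+ con 0ℚ) :* w := w) refl (two * (K + 1ℚ) * h))
      factor-yes (no ¬s) s = contradiction s ¬s

      1≤nine : 1ℚ ≤ nine
      1≤nine = ≤-by (nine - 1ℚ) (nonNegative⁻¹ (nine - 1ℚ)) refl

      1≤nine^ : ∀ m → 1ℚ ≤ nine ^ m
      1≤nine^ zero    = ≤-refl
      1≤nine^ (suc m) = *-mono 0≤1 (≤-trans 0≤1 (1≤nine^ m)) 1≤nine (1≤nine^ m)

      -- Number of columns times volume factors over the coordinates: the special factor is of order
      -- `h`, all others are at most `nine`.
      total≤ : fromNat (length columns) * boxVolume ≤ scaleFactor * h
      total≤ = ≤-trans (≤-reflexive columns-volume) (≤-trans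
        (∏-≤-at (λ i → ∏ᵠ λ j → factor (special? i j)) i₀ (1≤nine^ c)
          (λ i → 0≤∏ (λ j → factor (special? i j)) λ j → 0≤factor (special? i j))
          (λ i i≢i₀ → ∏-≤-^ (λ j → factor (special? i j)) (λ j → 0≤factor (special? i j))
            (λ j → factor-no (special? i j) (i≢i₀ ∘ proj₁)))
          (∏-≤-at (λ j → factor (special? i₀ j)) j₀ 1≤nine (λ j → 0≤factor (special? i₀ j))
            (λ j j≢j₀ → factor-no (special? i₀ j) (j≢j₀ ∘ proj₂))
            (factor-yes (special? i₀ j₀) (refl , refl))))
        (≤-reflexive (solve 4 (λ a h b d → a :* h :* b :* d := a :* b :* d :* h) refl
          (two * (K + 1ℚ)) h (nine ^ c) ((nine ^ c) ^ r))))

      Occupied : Index → Set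
      Occupied v = ∃[ q ] (Near q × InColumn v q)

      boxes : ∀ {vs} → All (λ v → Dec (Occupied v)) vs → List (Box r c)
      boxes []                     = []
      boxes {v ∷ _} (yes (q , _) ∷ ds) = box v q ∷ boxes ds
      boxes         (no _        ∷ ds) = boxes ds

      length-boxes : ∀ {vs} (ds : All (λ v → Dec (Occupied v)) vs) → length (boxes ds) ℕ.≤ length vs
      length-boxes []           = ℕ.z≤n
      length-boxes (yes _ ∷ ds) = ℕ.s≤s (length-boxes ds)
      length-boxes (no _  ∷ ds) = ℕₚ.m≤n⇒m≤1+n (length-boxes ds)

      volume-boxes : ∀ {vs} (ds : All (λ v → Dec (Occupied v)) vs) → All (λ b → volume b ≤ boxVolume) (boxes ds)
      volume-boxes []                         = []
      volume-boxes {v ∷ _} (yes (q , _) ∷ ds) = ≤-reflexive (volume-box v q) ∷ volume-boxes ds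
      volume-boxes         (no _        ∷ ds) = volume-boxes ds

      occupied-box : ∀ {vs v} (ds : All (λ v → Dec (Occupied v)) vs) → v ∈ vs → Occupied v →
        ∃[ q ] (Near q × InColumn v q × ∃[ l ] (listFamily (boxes ds) l ≡ just (box v q)))
      occupied-box (yes (q , near , inC) ∷ ds) (here refl) _ = q , near , inC , 0 , refl
      occupied-box (no ¬occ ∷ ds) (here refl) occ = contradiction occ ¬occ
      occupied-box (no _  ∷ ds) (there v∈) occ = occupied-box ds v∈ occ
      occupied-box (yes _ ∷ ds) (there v∈) occ with occupied-box ds v∈ occ
      ... | q , near , inC , l , eq = q , near , inC , suc l , eq

      grid-cell : ∀ q → Near q → ∀ i j →
        ∃[ l ] (l ℕ.< m × fromNat l * h ≤ q i j + 1ℚ × q i j + 1ℚ ≤ fromNat (suc l) * h)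
      grid-cell q near i j = cell 0≤h (n ℕ.+ (suc n ℕ.+ suc n)) (q i j + 1ℚ)
        (≤-trans (≤-reflexive (sym (+-inverseˡ 1ℚ))) (+-monoˡ-≤ 1ℚ (proj₁ (bounded q near i j))))
        (≤-trans (+-monoˡ-≤ 1ℚ (proj₂ (bounded q near i j))) (≤-reflexive (trans (+-comm two 1ℚ) (sym mh≡3))))

      column-of : ∀ q → Near q → ∃[ v ] (v ∈ columns × InColumn v q)
      column-of q near = v , tabulate∈choices row (λ i → Vec.tabulate λ j → proj₁ (g i j (special? i j)))
          (λ i → tabulate∈choices (λ j → cells (special? i j)) (λ j → proj₁ (g i j (special? i j)))
            λ j → proj₁ (proj₂ (g i j (special? i j)))) ,
        λ i j ¬s → subst (λ l → fromNat l * h ≤ q i j + 1ℚ × q i j + 1ℚ ≤ fromNat (suc l) * h)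
          (sym (at-v i j)) (proj₂ (proj₂ (g i j (special? i j))) ¬s)
        where
        g : ∀ i j (d : Dec (Special i j)) → ∃[ l ] (l ∈ cells d ×
          (¬ Special i j → fromNat l * h ≤ q i j + 1ℚ × q i j + 1ℚ ≤ fromNat (suc l) * h))
        g i j (yes s) = 0 , here refl , λ ¬s → contradiction s ¬s
        g i j (no _) = let l , l< , lo≤ , ≤hi = grid-cell q near i j in l , ∈-upTo⁺ l< , λ _ → lo≤ , ≤hi
        v : Index
        v = Vec.tabulate λ i → Vec.tabulate λ j → proj₁ (g i j (special? i j))
        at-v : ∀ i j → at v i j ≡ proj₁ (g i j (special? i j))
        at-v i j = trans (cong (λ w → Vec.lookup w j) (lookup∘tabulate (λ i → Vec.tabulate λ j → proj₁ (g i j (special? i j))) i))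
          (lookup∘tabulate (λ j → proj₁ (g i j (special? i j))) j)

      close-in-column : ∀ v q q′ → InColumn v q → InColumn v q′ → ∀ i j → ¬ Special i j → q i j ≤ q′ i j + h
      close-in-column v q q′ inC inC′ i j ¬s = ≤-by ((hiv - (q i j + 1ℚ)) + ((q′ i j + 1ℚ) - lov))
        (0≤+ (≤⇒0≤- (proj₂ (inC i j ¬s))) (≤⇒0≤- (proj₁ (inC′ i j ¬s))))
        (solve 4 (λ a b h l → b :+ h := a :+ (((con 1ℚ :+ l) :* h :- (a :+ con 1ℚ)) :+ ((b :+ con 1ℚ) :- l :* h)))
          refl (q i j) (q′ i j) h (fromNat (at v i j)))
        where
        lov hiv : ℚ
        lov = fromNat (at v i j) * h
        hiv = fromNat (suc (at v i j)) * h

      -- `q` approximates `x` itself, while the box was built on `q′`. Both lie in column `v`, so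
      -- `graph`, used in both directions, bounds their distance in the special coordinate.
      ∈-box : ∀ v x q q′ → Near q → Close h x q → InColumn v q → Near q′ → InColumn v q′ → x ∈ᴮ box v q′
      ∈-box v x q q′ near close inC near′ inC′ i j = go (special? i j)
        where
        go : (d : Dec (Special i j)) → fromℚ (lo v q′ i j d) ≤ᴿ x i j × x i j ≤ᴿ fromℚ (hi v q′ i j d)
        go (yes (refl , refl)) =
          fromℚ-≤ᴿ {q = q i j - h} {x = x i j} (≤-by (q i j + K * h - q′ i j)
              (≤⇒0≤- (graph q′ q near′ near λ a b ¬s → close-in-column v q′ q inC′ inC a b ¬s , close-in-column v q q′ inC inC′ a b ¬s))
              (solve 4 (λ a b k h → a :- h := b :- (k :+ h) :+ (a :+ k :- b)) refl (q i j) (q′ i j) (K * h) h))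
            (proj₁ (close i j)) ,
          ≤ᴿ-fromℚ {p = q i j + h} {x = x i j} (≤-by (q′ i j + K * h - q i j)
              (≤⇒0≤- (graph q q′ near near′ λ a b ¬s → close-in-column v q q′ inC inC′ a b ¬s , close-in-column v q′ q inC′ inC a b ¬s))
              (solve 4 (λ a b k h → b :+ (k :+ h) := a :+ h :+ (b :+ k :- a)) refl (q i j) (q′ i j) (K * h) h))
            (proj₂ (close i j))
        go (no ¬s) =
          fromℚ-≤ᴿ {q = q i j - h} {x = x i j} (≤-by (q i j + 1ℚ - l * h) (≤⇒0≤- (proj₁ (inC i j ¬s)))
              (solve 3 (λ a l h → a :- h := l :- con 1ℚ :- h :+ (a :+ con 1ℚ :- l)) refl (q i j) (l * h) h))
            (proj₁ (close i j)) ,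
          ≤ᴿ-fromℚ {p = q i j + h} {x = x i j} (≤-by ((1ℚ + l) * h - (q i j + 1ℚ)) (≤⇒0≤- (proj₂ (inC i j ¬s)))
              (solve 3 (λ a l h → l :- con 1ℚ :+ h := a :+ h :+ (l :- (a :+ con 1ℚ))) refl (q i j) ((1ℚ + l) * h) h))
            (proj₂ (close i j))
          where
          l : ℚ
          l = fromNat (at v i j)

      boxes-cover : (ds : All (λ v → Dec (Occupied v)) columns) → Covers (listFamily (boxes ds)) S
      boxes-cover ds x x∈S ¬any = approx x x∈S covered
        where
        covered : ¬ (∃[ q ] (Near q × Close h x q))
        covered (q , near , close) with column-of q near
        ... | v , v∈ , inC with occupied-box ds v∈ (q , near , inC)
        ... | q′ , near′ , inC′ , l , B≡ =
          ¬any (l , subst (Maybe.Any (x ∈ᴮ_)) (sym B≡) (Maybe.just (∈-box v x q q′ near close inC near′ inC′)))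

      boxes-small : (ds : All (λ v → Dec (Occupied v)) columns) →
        ∀ N → partialVolume (listFamily (boxes ds)) N ≤ scaleFactor * h
      boxes-small ds N = ≤-trans (partialVolume-listFamily (boxes ds) 0≤boxVolume (volume-boxes ds) N)
        (≤-trans (*-monoʳ {boxVolume} {fromNat (length (boxes ds))} {fromNat (length columns)}
          0≤boxVolume (fromNat-mono {length (boxes ds)} {length columns} (length-boxes ds))) total≤)

    thin⇒¬positive : ∀ {h₀} → 0ℚ < h₀ → (∀ h → 0ℚ < h → h ≤ h₀ → Approximation S i₀ j₀ K h) → ¬ PositiveMeasure S
    thin⇒¬positive {h₀} 0<h₀ appr (ε , 0<ε , large) = conclude (mesh scaleFactor 0≤scaleFactor 0<h₀ 0<ε)
      where
      0≤9 : 0ℚ ≤ nine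
      0≤9 = nonNegative⁻¹ nine
      0≤scaleFactor : 0ℚ ≤ scaleFactor
      0≤scaleFactor = 0≤* (0≤* (0≤* (0≤+ 0≤1 0≤1) (0≤+ 0≤K 0≤1)) (0≤^ c 0≤9)) (0≤^ r (0≤^ c 0≤9))
      conclude : ¬ (∃[ n ] ∃[ h ] (0ℚ < h × fromNat (suc n) * h ≡ 1ℚ × h ≤ h₀ × scaleFactor * h ≤ ε))
      -- Whether a column is occupied need not be decidable, but the goal is a negation and the
      -- columns are finitely many, so all answers may be assumed known.
      conclude (n , h , 0<h , nh≡1 , h≤h₀ , Xh≤ε) = ¬¬-All-Dec Occupied columns λ ds →
        large (listFamily (boxes ds)) (boxes-cover ds) λ N → ≤-trans (boxes-small ds N) Xh≤ε
        where open Cover n h 0<h nh≡1 (appr h 0<h h≤h₀)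

  -- Rational approximations of a chain

  Eventually : (ℕ → Set) → Set
  Eventually P = ∃[ N ] (∀ n → N ℕ.≤ n → P n)

  _∩_ : ∀ {P Q : ℕ → Set} → Eventually P → Eventually Q → Eventually (λ n → P n × Q n)
  (M , p) ∩ (N , q) = M ℕ.⊔ N , λ n ≤n → p n (ℕₚ.m⊔n≤o⇒m≤o M N ≤n) , q n (ℕₚ.m⊔n≤o⇒n≤o M N ≤n)

  ⋂ : ∀ {k} {P : Fin k → ℕ → Set} → (∀ i → Eventually (P i)) → Eventually (λ n → ∀ i → P i n)
  ⋂ {zero}  ev = 0 , λ _ _ ()
  ⋂ {suc k} ev with ev zero ∩ ⋂ (ev ∘ suc)
  ... | N , p = N , λ n ≤n → λ { zero → proj₁ (p n ≤n) ; (suc i) → proj₂ (p n ≤n) i }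

  -- This lets optimality be tested against all state sequences at one common stage. Vectors can be
  -- enumerated by recursion; functions on `Fin` only up to pointwise equality.
  ⋂ⱽ : ∀ {k m} {P : Vec (Fin k) m → ℕ → Set} → (∀ v → Eventually (P v)) → Eventually (λ n → ∀ v → P v n)
  ⋂ⱽ {m = zero}  ev with ev []
  ... | N , p = N , λ n ≤n → λ { [] → p n ≤n }
  ⋂ⱽ {m = suc m} ev with ⋂ (λ i → ⋂ⱽ (λ v → ev (i ∷ v)))
  ... | N , p = N , λ n ≤n → λ { (i ∷ v) → p n ≤n i v }

  ½*-pos : ∀ {ε} → 0ℚ < ε → 0ℚ < ½ * ε
  ½*-pos = 0<* (positive⁻¹ ½)

  ½+½ : ∀ ε → ½ * ε + ½ * ε ≡ ε
  ½+½ ε = trans (sym (*-distribʳ-+ ε ½ ½)) (*-identityˡ ε)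

  ≤ᴿ-trans : ∀ x y z → x ≤ᴿ y → y ≤ᴿ z → x ≤ᴿ z
  ≤ᴿ-trans x y z x≤y y≤z ε ε>0 with x≤y (½ * ε) (½*-pos ε>0) ∩ y≤z (½ * ε) (½*-pos ε>0)
  ... | N , le = N , λ n ≤n → ≤-trans (proj₁ (le n ≤n)) (≤-trans (+-monoˡ-≤ (½ * ε) (proj₂ (le n ≤n)))
    (≤-reflexive (trans (+-assoc (seq z n) (½ * ε) (½ * ε)) (cong (seq z n +_) (½+½ ε)))))

  p≤∣p∣ : ∀ p → p ≤ ∣ p ∣
  p≤∣p∣ p with 0ℚ ≤? p
  ... | yes 0≤p = ≤-reflexive (sym (0≤p⇒∣p∣≡p 0≤p))
  ... | no 0≰p = ≤-trans (<⇒≤ (≰⇒> 0≰p)) (0≤∣p∣ p)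

  ∣-∣-≤ : ∀ {p q h} → ∣ p - q ∣ ≤ h → p ≤ q + h
  ∣-∣-≤ {p} {q} {h} le = ≤-by (h - (p - q)) (≤⇒0≤- (≤-trans (p≤∣p∣ (p - q)) le))
    (solve 3 (λ p q h → q :+ h := p :+ (h :- (p :- q))) refl p q h)

  seq-close : ∀ x {η} → 0ℚ < η → Eventually (λ t → fromℚ (seq x t - η) ≤ᴿ x × x ≤ᴿ fromℚ (seq x t + η))
  seq-close x {η} 0<η with cauchy x η 0<η
  ... | N , near = N , λ t N≤t →
    (λ ε ε>0 → N , λ n N≤n → ≤-trans (≤-by {y = seq x n} (seq x n + η - seq x t) (≤⇒0≤- (∣-∣-≤ {seq x t} {seq x n} (near t n N≤t N≤n)))
        (solve 3 (λ a b h → b := a :- h :+ (b :+ h :- a)) refl (seq x t) (seq x n) η))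
      (≤-by {seq x n} ε (<⇒≤ ε>0) refl)) ,
    (λ ε ε>0 → N , λ n N≤n → ≤-trans (∣-∣-≤ {seq x n} {seq x t} (near n t N≤n N≤t)) (≤-by {seq x t + η} ε (<⇒≤ ε>0) refl))

  entry : ∀ {k} → MarkovChain k → Fin (suc k) → Fin k → ℝ
  entry M zero    j = π M j
  entry M (suc i) j = p M i j

  stage : ∀ {k} → MarkovChain k → ℕ → Fin (suc k) → Fin k → ℚ
  stage M t i j = seq (entry M i j) t

  edgeWeight : ∀ {k} → (Fin (suc k) → Fin k → ℚ) → Fin k × Fin k → ℚ
  edgeWeight Q (i , j) = Q (suc i) j

  Prᵠ : ∀ {k n} → (Fin (suc k) → Fin k → ℚ) → Sequence k n → ℚ
  Prᵠ Q s = Q zero (s zero) * weight (edgeWeight Q) (transitions s)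

  seq-∑ : ∀ {n} (f : Fin n → ℝ) t → seq (∑ f) t ≡ ∑ᵠ (λ i → seq (f i) t)
  seq-∑ {zero}  f t = refl
  seq-∑ {suc n} f t = cong (seq (f zero) t +_) (seq-∑ (f ∘ suc) t)

  seq-∏ : ∀ {A : Set} {n} (F : A → ℝ) (g : Fin n → A) t →
    seq (∏ (F ∘ g)) t ≡ weight (λ e → seq (F e) t) (tabulate g)
  seq-∏ {n = zero}  F g t = refl
  seq-∏ {n = suc n} F g t = cong (seq (F (g zero)) t *_) (seq-∏ F (g ∘ suc) t)

  seq-Pr : ∀ {k n} (M : MarkovChain k) (s : Sequence k n) t → seq (Pr M s) t ≡ Prᵠ (stage M t) s
  seq-Pr M s t = cong (seq (π M (s zero)) t *_) (seq-∏ (λ (i , j) → p M i j) (transition s) t)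

  -- Competitors are listed as vectors, and looking up a tabulated sequence returns it only
  -- pointwise.
  Prᵠ-cong : ∀ {k n} Q (s s′ : Sequence k n) → (∀ t → s t ≡ s′ t) → Prᵠ Q s ≡ Prᵠ Q s′
  Prᵠ-cong Q s s′ s≡s′ = cong₂ (λ i es → Q zero i * weight (edgeWeight Q) es) (s≡s′ zero)
    (tabulate-cong λ t → cong₂ _,_ (s≡s′ (inject₁ t)) (s≡s′ (suc t)))

  -- What survives, up to η, of a chain with Viterbi path `s` when its reals are replaced by late
  -- terms of their Cauchy sequences. Such a `Q` need not be a chain: entries may be slightly
  -- negative.
  record AlmostViterbi {k n} (s : Sequence k n) (η : ℚ) (Q : Fin (suc k) → Fin k → ℚ) : Set where
    field
      almost-nonNeg : ∀ i j → 0ℚ ≤ Q i j + η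
      1≤∑           : ∀ i → 1ℚ ≤ ∑ᵠ (Q i) + η
      ∑≤1           : ∀ i → ∑ᵠ (Q i) ≤ 1ℚ + η
      almost-best   : ∀ (v : Vec (Fin k) (suc n)) → Prᵠ {n = n} Q (Vec.lookup v) ≤ Prᵠ Q s + η

  stage-almostViterbi : ∀ {k n} (M : MarkovChain k) (s : Sequence k n) → IsViterbiPath M s → ∀ {η} → 0ℚ < η →
    ∃[ t ] (AlmostViterbi s η (stage M t) × Close η (entry M) (stage M t))
  stage-almostViterbi {k} {n} M s best {η} 0<η =
    conclude (⋂ (λ i → ⋂ (λ j → nonNeg i j)) ∩ (⋂ lower∑ ∩ (⋂ upper∑ ∩ (⋂ⱽ bestⱽ ∩ ⋂ (λ i → ⋂ (λ j → seq-close (entry M i j) 0<η))))))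
    where
    nonNeg : ∀ i j → Eventually (λ t → 0ℚ ≤ stage M t i j + η)
    nonNeg zero    j = proj₁ (π-distribution M) j η 0<η
    nonNeg (suc i) j = proj₁ (p-stochastic M i) j η 0<η
    distribution : ∀ i → ∑ (entry M i) ≈ᴿ 1ᴿ
    distribution zero    = proj₂ (π-distribution M)
    distribution (suc i) = proj₂ (p-stochastic M i)
    lower∑ : ∀ i → Eventually (λ t → 1ℚ ≤ ∑ᵠ (stage M t i) + η)
    lower∑ i with proj₂ (distribution i) η 0<η
    ... | N , le = N , λ t ≤t → subst (λ z → 1ℚ ≤ z + η) (seq-∑ (entry M i) t) (le t ≤t)
    upper∑ : ∀ i → Eventually (λ t → ∑ᵠ (stage M t i) ≤ 1ℚ + η)
    upper∑ i with proj₁ (distribution i) η 0<η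
    ... | N , le = N , λ t ≤t → subst (_≤ 1ℚ + η) (seq-∑ (entry M i) t) (le t ≤t)
    bestⱽ : ∀ (v : Vec (Fin k) (suc n)) → Eventually (λ t → Prᵠ {n = n} (stage M t) (Vec.lookup v) ≤ Prᵠ (stage M t) s + η)
    bestⱽ v with best (Vec.lookup v) η 0<η
    ... | N , le = N , λ t ≤t → subst (_≤ Prᵠ (stage M t) s + η) (seq-Pr M (Vec.lookup v) t)
      (subst (λ z → seq (Pr M (Vec.lookup v)) t ≤ z + η) (seq-Pr M s t) (le t ≤t))
    conclude : Eventually (λ t → (∀ i j → 0ℚ ≤ stage M t i j + η) × (∀ i → 1ℚ ≤ ∑ᵠ (stage M t i) + η) ×
      (∀ i → ∑ᵠ (stage M t i) ≤ 1ℚ + η) × (∀ (v : Vec (Fin k) (suc n)) → Prᵠ {n = n} (stage M t) (Vec.lookup v) ≤ Prᵠ (stage M t) s + η) ×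
      Close η (entry M) (stage M t)) → ∃[ t ] (AlmostViterbi s η (stage M t) × Close η (entry M) (stage M t))
    conclude (t , all) with all t ℕₚ.≤-refl
    ... | nn , lo , hi , bst , close = t , record
      { almost-nonNeg = nn ; 1≤∑ = lo ; ∑≤1 = hi ; almost-best = bst } , close

  0<-cancelʳ : ∀ {x y} → 0ℚ < y → 0ℚ < x * y → 0ℚ < x
  0<-cancelʳ {x} {y} 0<y 0<xy with 0ℚ <? x
  ... | yes 0<x = 0<x
  ... | no  0≮x = contradiction (<-≤-trans 0<xy (≤-trans (*-monoʳ (<⇒≤ 0<y) (≮⇒≥ 0≮x)) (≤-reflexive (*-zeroˡ y)))) (<-irrefl refl)

  -- Absolute values, because at a stage some factors may be slightly negative and products of them
  -- are not monotone.
  ∣weight∣≤ : ∀ {A : Set} (w : A → ℚ) {c} xs → 1ℚ ≤ c → (∀ x → ∣ w x ∣ ≤ c) → ∣ weight w xs ∣ ≤ c ^ length xs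
  ∣weight∣≤ w     []       1≤c w≤c = ≤-refl
  ∣weight∣≤ w {c} (x ∷ xs) 1≤c w≤c = ≤-trans (≤-reflexive (∣p*q∣≡∣p∣*∣q∣ (w x) (weight w xs)))
    (*-mono (0≤∣p∣ (w x)) (0≤^ (length xs) (≤-trans 0≤1 1≤c)) (w≤c x) (∣weight∣≤ w xs 1≤c w≤c))

  ∣weight∣≤-at : ∀ {A : Set} (w : A → ℚ) {c} xs → 1ℚ ≤ c → (∀ x → ∣ w x ∣ ≤ c) →
    ∀ {e} → e ∈ xs → ∣ weight w xs ∣ ≤ ∣ w e ∣ * c ^ length xs
  ∣weight∣≤-at w {c} (e ∷ xs) 1≤c w≤c (here refl) = ≤-trans (≤-reflexive (∣p*q∣≡∣p∣*∣q∣ (w e) (weight w xs)))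
    (*-monoˡ (0≤∣p∣ (w e)) (≤-trans (∣weight∣≤ w xs 1≤c w≤c)
      (≤-trans (≤-reflexive (sym (*-identityˡ (c ^ length xs)))) (*-monoʳ (0≤^ (length xs) (≤-trans 0≤1 1≤c)) 1≤c))))
  ∣weight∣≤-at w {c} (x ∷ xs) 1≤c w≤c {e} (there e∈) = ≤-trans (≤-reflexive (∣p*q∣≡∣p∣*∣q∣ (w x) (weight w xs)))
    (≤-trans (*-mono (0≤∣p∣ (w x)) (0≤* (0≤∣p∣ (w e)) (0≤^ (length xs) (≤-trans 0≤1 1≤c))) (w≤c x) (∣weight∣≤-at w xs 1≤c w≤c e∈))
      (≤-reflexive (solve 3 (λ c a b → c :* (a :* b) := a :* (c :* b)) refl c (∣ w e ∣) (c ^ length xs))))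

  ^-≤-weight : ∀ {A : Set} (w : A → ℚ) {c} xs → 0ℚ ≤ c → (∀ {x} → x ∈ xs → c ≤ w x) → c ^ length xs ≤ weight w xs
  ^-≤-weight w     []       0≤c c≤w = ≤-refl
  ^-≤-weight w {c} (x ∷ xs) 0≤c c≤w = *-mono 0≤c (≤-trans (0≤^ (length xs) 0≤c) ih) (c≤w (here refl)) ih
    where
    ih : c ^ length xs ≤ weight w xs
    ih = ^-≤-weight w xs 0≤c (c≤w ∘ there)

  ∣-∣≤ : ∀ {x c} → - c ≤ x → x ≤ c → ∣ x ∣ ≤ c
  ∣-∣≤ {x} {c} -c≤x x≤c with 0ℚ ≤? x
  ... | yes 0≤x = ≤-trans (≤-reflexive (0≤p⇒∣p∣≡p 0≤x)) x≤c
  ... | no  0≰x = ≤-trans (≤-reflexive (trans (sym (∣-p∣≡∣p∣ x)) (0≤p⇒∣p∣≡p (neg-antimono-≤ (<⇒≤ (≰⇒> 0≰x))))))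
    (≤-trans (neg-antimono-≤ -c≤x) (≤-reflexive (solve 1 (λ c → :- (:- c) := c) refl c)))

  -- The form in which the comparison uses a point of the region: only the scale `h` is left, the
  -- finer error η is absorbed, and optimality is reduced to the tie of `W` and `C` up to a factor 1
  -- + h.
  record Balanced {k n} (s : Sequence k n) (W C : List (Fin k × Fin k)) (δ h : ℚ) (Q : Fin (suc k) → Fin k → ℚ) : Set where
    field
      -1≤Q : ∀ i j → - 1ℚ ≤ Q i j
      Q≤2  : ∀ i j → Q i j ≤ two
      1≤∑  : ∀ i → 1ℚ ≤ ∑ᵠ (Q i) + h
      ∑≤1  : ∀ i → ∑ᵠ (Q i) ≤ 1ℚ + h
      δ≤   : ∀ {e} → e ∈ transitions s → δ ≤ edgeWeight Q e
      W≤C  : weight (edgeWeight Q) W ≤ (1ℚ + h) * weight (edgeWeight Q) C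
      C≤W  : weight (edgeWeight Q) C ≤ (1ℚ + h) * weight (edgeWeight Q) W

  -- ρ = 1 / (k + 1) is below the mean 1 / k of a row, leaving room for η, so every row has an entry
  -- at least ρ. The greedy path then has probability at least ρ^(n+1) = 2σ, of which one σ pays for
  -- η. Since all entries are at most 2, a factor of a product at least σ is at least δ = σ /
  -- 2^(n+1).
  module _ {k n : ℕ} (s : Sequence k n) (Q : Fin (suc k) → Fin k → ℚ) {ρ σ δ η h : ℚ}
    (0<ρ : 0ℚ < ρ) (0<σ : 0ℚ < σ) (0<δ : 0ℚ < δ) (0<η : 0ℚ < η) (0<h : 0ℚ < h)
    (kρ≡1 : fromNat (suc k) * ρ ≡ 1ℚ) (σ+σ≡ : σ + σ ≡ ρ ^ suc n) (δ≡ : two ^ suc n * δ ≡ σ)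
    (η<ρ : η < ρ) (η≤σ : η ≤ σ) (η<δ : η < δ) (η≤h : η ≤ h) (η≤hσ : η ≤ h * σ)
    (av : AlmostViterbi s η Q) where

    open AlmostViterbi av

    private
      ρ≤1 : ρ ≤ 1ℚ
      ρ≤1 = ≤-by (fromNat k * ρ) (0≤* (0≤fromNat k) (<⇒≤ 0<ρ))
        (trans (sym kρ≡1) (solve 2 (λ k ρ → (con 1ℚ :+ k) :* ρ := ρ :+ k :* ρ) refl (fromNat k) ρ))

      -η≤ : ∀ i j → - η ≤ Q i j
      -η≤ i j = ≤-by (Q i j + η) (almost-nonNeg i j) (solve 2 (λ q η → q := :- η :+ (q :+ η)) refl (Q i j) η)

      -1≤ : ∀ i j → - 1ℚ ≤ Q i j
      -1≤ i j = ≤-trans (neg-antimono-≤ (≤-trans (<⇒≤ η<ρ) ρ≤1)) (-η≤ i j)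

      ≤2 : ∀ i j → Q i j ≤ two
      ≤2 i j = ≤-trans (entry≤∑ (Q i) j (<⇒≤ 0<η) (-η≤ i)) (≤-trans (+-monoˡ-≤ (fromNat k * η) (∑≤1 i))
        (≤-trans (≤-reflexive (solve 2 (λ k η → con 1ℚ :+ η :+ k :* η := con 1ℚ :+ (con 1ℚ :+ k) :* η) refl (fromNat k) η))
          (+-monoʳ-≤ 1ℚ (≤-trans (*-monoˡ (0≤fromNat (suc k)) (<⇒≤ η<ρ)) (≤-reflexive kρ≡1)))))

      abstract
        large : ∀ i → ∃[ j ] (ρ ≤ Q i j)
        large i = large-entry {c = ρ} (Q i) (<-≤-trans (subst (_< 1ℚ - η) 1-ρ≡kρ (+-monoʳ-< 1ℚ (neg-antimono-< η<ρ)))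
          (≤-by (∑ᵠ (Q i) + η - 1ℚ) (≤⇒0≤- (1≤∑ i))
            (solve 2 (λ S η → S := con 1ℚ :- η :+ (S :+ η :- con 1ℚ)) refl (∑ᵠ (Q i)) η)))
          where
          1-ρ≡kρ : 1ℚ - ρ ≡ fromNat k * ρ
          1-ρ≡kρ = trans (cong (_- ρ) (sym kρ≡1))
            (solve 2 (λ k ρ → (con 1ℚ :+ k) :* ρ :- ρ := k :* ρ) refl (fromNat k) ρ)

      greedy : ℕ → Fin k
      greedy zero    = proj₁ (large zero)
      greedy (suc t) = proj₁ (large (suc (greedy t)))

      path : Sequence k n
      path = greedy ∘ toℕ

      ρ≤path : ∀ {e} → e ∈ transitions path → ρ ≤ edgeWeight Q e
      ρ≤path e∈ with ∈-tabulate⁻ {f = transition path} e∈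
      ... | t , refl rewrite Finₚ.toℕ-inject₁ t = proj₂ (large (suc (greedy (toℕ t))))

      ≤Pr-path : ρ ^ suc n ≤ Prᵠ Q path
      ≤Pr-path = *-mono (<⇒≤ 0<ρ) (≤-trans (0≤^ n (<⇒≤ 0<ρ)) ρⁿ≤) (proj₂ (large zero)) ρⁿ≤
        where
        ρⁿ≤ : ρ ^ n ≤ weight (edgeWeight Q) (transitions path)
        ρⁿ≤ = subst (λ m → ρ ^ m ≤ weight (edgeWeight Q) (transitions path)) (length-tabulate (transition path))
          (^-≤-weight (edgeWeight Q) (transitions path) (<⇒≤ 0<ρ) ρ≤path)

      best : ∀ s′ → Prᵠ Q s′ ≤ Prᵠ Q s + η
      best s′ = subst (_≤ Prᵠ Q s + η) (Prᵠ-cong Q (Vec.lookup (Vec.tabulate s′)) s′ (lookup∘tabulate s′)) (almost-best (Vec.tabulate s′))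

      σ≤Pr : σ ≤ Prᵠ Q s
      σ≤Pr = ≤-by ((Prᵠ Q s + η - (σ + σ)) + (σ - η))
        (0≤+ (≤⇒0≤- (≤-trans (≤-reflexive σ+σ≡) (≤-trans ≤Pr-path (best path)))) (≤⇒0≤- η≤σ))
        (solve 3 (λ p η σ → p := σ :+ ((p :+ η :- (σ :+ σ)) :+ (σ :- η))) refl (Prᵠ Q s) η σ)

      ∣Q∣≤2 : ∀ i j → ∣ Q i j ∣ ≤ two
      ∣Q∣≤2 i j = ∣-∣≤ (≤-trans (neg-antimono-≤ 1≤two) (-1≤ i j)) (≤2 i j)

      -- The product `Prᵠ Q s` is at least σ and its other factors are at most 2 in absolute value,
      -- so no used factor can be small.
      δ≤used : ∀ {e} → e ∈ transitions s → δ ≤ edgeWeight Q e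
      δ≤used {e} e∈ = conclude (0ℚ ≤? w)
        where
        w : ℚ
        w = edgeWeight Q e
        D : ℚ
        D = two ^ suc n
        0<D : 0ℚ < D
        0<D = 0<^ {two} (suc n) 0<two
        δ≤∣w∣ : δ ≤ ∣ w ∣
        δ≤∣w∣ = *-cancelˡ {D} {δ} {∣ w ∣} 0<D (begin
          D * δ                      ≡⟨ δ≡ ⟩
          σ                          ≤⟨ σ≤Pr ⟩
          q * u                      ≤⟨ p≤∣p∣ (q * u) ⟩
          ∣ q * u ∣                  ≡⟨ ∣p*q∣≡∣p∣*∣q∣ q u ⟩
          ∣ q ∣ * ∣ u ∣              ≤⟨ *-mono {∣ q ∣} {two} {∣ u ∣} {∣ w ∣ * two ^ n} (0≤∣p∣ q) (0≤* (0≤∣p∣ w) (0≤^ {two} n (<⇒≤ 0<two))) (∣Q∣≤2 zero (s zero)) ∣u∣≤ ⟩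
          two * (∣ w ∣ * two ^ n)    ≡⟨ solve 3 (λ t a b → t :* (a :* b) := t :* b :* a) refl two (∣ w ∣) (two ^ n) ⟩
          D * ∣ w ∣                  ∎)
          where
          open ≤-Reasoning
          q u : ℚ
          q = Q zero (s zero)
          u = weight (edgeWeight Q) (transitions s)
          ∣u∣≤ : ∣ u ∣ ≤ ∣ w ∣ * two ^ n
          ∣u∣≤ = subst (λ m → ∣ u ∣ ≤ ∣ w ∣ * two ^ m) (length-tabulate (transition s))
            (∣weight∣≤-at (edgeWeight Q) (transitions s) 1≤two (λ (i , j) → ∣Q∣≤2 (suc i) j) e∈)
        conclude : Dec (0ℚ ≤ w) → δ ≤ w
        conclude (yes 0≤w) = ≤-trans δ≤∣w∣ (≤-reflexive (0≤p⇒∣p∣≡p 0≤w))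
        -- A negative entry is at least -η, so its absolute value would be below δ.
        conclude (no 0≰w)  = contradiction (<-≤-trans η<δ (≤-trans δ≤∣w∣ (∣-∣≤ (-η≤ (suc (proj₁ e)) (proj₂ e))
          (≤-trans (<⇒≤ (≰⇒> 0≰w)) (<⇒≤ 0<η))))) (<-irrefl refl)

    module _ {R W C : List (Fin k × Fin k)} (s↭ : transitions s ↭ R ++ W ++ C) where

      private
        w : List (Fin k × Fin k) → ℚ
        w = weight (edgeWeight Q)

        0<w : ∀ xs → (∀ {e} → e ∈ xs → e ∈ R ++ W ++ C) → 0ℚ < w xs
        0<w xs xs⊆ = 0<weight (edgeWeight Q) xs λ e∈ → <-≤-trans 0<δ (δ≤used (∈-resp-↭ (↭-sym s↭) (xs⊆ e∈)))

        Prᵠ-split : ∀ (s′ : Sequence k n) X Y → s′ zero ≡ s zero → transitions s′ ↭ R ++ X ++ Y →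
          Prᵠ Q s′ ≡ Q zero (s zero) * w R * w X * w Y
        Prᵠ-split s′ X Y s′0≡ s′↭ = trans (cong₂ (λ i z → Q zero i * z) s′0≡
            (trans (weight-↭ (edgeWeight Q) s′↭) (trans (weight-++ (edgeWeight Q) R (X ++ Y))
              (cong (w R *_) (weight-++ (edgeWeight Q) X Y)))))
          (solve 4 (λ q r x y → q :* (r :* (x :* y)) := q :* r :* x :* y) refl (Q zero (s zero)) (w R) (w X) (w Y))

        -- With z the common factor of Pr s = z x and of the competitor's probability z y.
        compare : ∀ {x y z} → 0ℚ < x → z * x ≡ Prᵠ Q s → z * y ≤ Prᵠ Q s + η → y ≤ (1ℚ + h) * x
        compare {x} {y} {z} 0<x zx≡ zy≤ = *-cancelˡ 0<z (≤-trans zy≤ (≤-trans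
            (+-monoʳ-≤ (Prᵠ Q s) (≤-trans η≤hσ (*-monoˡ (<⇒≤ 0<h) σ≤Pr)))
            (≤-reflexive (trans (cong (λ p → p + h * p) (sym zx≡))
              (solve 3 (λ z x h → z :* x :+ h :* (z :* x) := z :* ((con 1ℚ :+ h) :* x)) refl z x h)))))
          where
          0<z : 0ℚ < z
          0<z = 0<-cancelʳ 0<x (<-≤-trans 0<σ (≤-trans σ≤Pr (≤-reflexive (sym zx≡))))

      -- Optimality of `s` is used against two competitors only. Against `s₂`, cancelling the
      -- initial factor, R and one W leaves W against C; against `s₁`, cancelling one C instead
      -- leaves the reverse. The additive error η becomes a relative error `h` because η is at most
      -- h times σ.
      almostViterbi⇒balanced : ∀ (s₁ s₂ : Sequence k n) → s₁ zero ≡ s zero → s₂ zero ≡ s zero →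
        transitions s₁ ↭ R ++ C ++ C → transitions s₂ ↭ R ++ W ++ W → Balanced s W C δ h Q
      almostViterbi⇒balanced s₁ s₂ s₁0≡ s₂0≡ s₁↭ s₂↭ = record
        { -1≤Q = -1≤
        ; Q≤2  = ≤2
        ; 1≤∑  = λ i → ≤-trans (1≤∑ i) (+-monoʳ-≤ (∑ᵠ (Q i)) η≤h)
        ; ∑≤1  = λ i → ≤-trans (∑≤1 i) (+-monoʳ-≤ 1ℚ η≤h)
        ; δ≤   = δ≤used
        ; W≤C  = compare {w C} {w W} {q * w R * w W} (0<w C (∈-++⁺ʳ R ∘ ∈-++⁺ʳ W)) (sym (Prᵠ-split s W C refl s↭))
                   (subst (_≤ Prᵠ Q s + η) (Prᵠ-split s₂ W W s₂0≡ s₂↭) (best s₂))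
        ; C≤W  = compare {w W} {w C} {q * w R * w C} (0<w W (∈-++⁺ʳ R ∘ ∈-++⁺ˡ))
                   (trans (solve 3 (λ z c x → z :* c :* x := z :* x :* c) refl (q * w R) (w C) (w W)) (sym (Prᵠ-split s W C refl s↭)))
                   (subst (_≤ Prᵠ Q s + η) (Prᵠ-split s₁ C C s₁0≡ s₁↭) (best s₁))
        }
        where
        q : ℚ
        q = Q zero (s zero)

  -- A tie determines one coordinate from the others

  -- The last entry of a row is one minus the others, so it moves opposite to any one of them.
  last-shift : ∀ {k h c} (f g : Fin (suc k) → ℚ) → 1ℚ ≤ ∑ᵠ f + h → ∑ᵠ g ≤ 1ℚ + h →
    ∑ᵠ (f ∘ inject₁) + c ≤ ∑ᵠ (g ∘ inject₁) + fromNat k * h →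
    g (fromℕ k) + c ≤ f (fromℕ k) + fromNat (suc (suc k)) * h
  last-shift {k} {h} {c} f g 1≤f g≤1 f≤g =
    ≤-by ((F + lf + h - 1ℚ) + (1ℚ + h - (G + lg)) + (G + fromNat k * h - (F + c)))
      (0≤+ (0≤+ (≤⇒0≤- (subst (λ z → 1ℚ ≤ z + h) (∑-last f) 1≤f)) (≤⇒0≤- (subst (_≤ 1ℚ + h) (∑-last g) g≤1))) (≤⇒0≤- f≤g))
      (solve 7 (λ F G lf lg h c k →
        lf :+ (con 1ℚ :+ (con 1ℚ :+ k)) :* h
        := lg :+ c :+ ((F :+ lf :+ h :- con 1ℚ) :+ (con 1ℚ :+ h :- (G :+ lg)) :+ (G :+ k :* h :- (F :+ c))))
        refl F G lf lg h c (fromNat k))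
    where
    F G lf lg : ℚ
    F  = ∑ᵠ (f ∘ inject₁)
    G  = ∑ᵠ (g ∘ inject₁)
    lf = f (fromℕ k)
    lg = g (fromℕ k)

  -- On entries at least δ, an additive change κ h is at most a relative change κ h / δ, so
  -- `balanced-close` applies with c = 1 + g. The chord bound makes the resulting power of c linear
  -- in g, and `w₁ e ≤ two` makes the error additive again; this bound 2 is the last of the three
  -- extra factors `two`.
  balanced-additive : ∀ {A : Set} (w₁ w₂ : A → ℚ) {δ δ⁻ κ h} W e C →
    0ℚ < δ → 0ℚ ≤ δ⁻ → δ * δ⁻ ≡ 1ℚ → 0ℚ ≤ κ → 0ℚ ≤ h → (κ * δ⁻ + 1ℚ) * h ≤ 1ℚ →
    (∀ {x} → x ∈ W → δ ≤ w₁ x × δ ≤ w₂ x × w₂ x ≤ w₁ x + κ * h) →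
    (∀ {x} → x ∈ C → δ ≤ w₁ x × δ ≤ w₂ x × w₁ x ≤ w₂ x + κ * h) →
    δ ≤ w₁ e → w₁ e ≤ two →
    weight w₁ W ≤ (1ℚ + h) * weight w₁ (e ∷ C) → weight w₂ (e ∷ C) ≤ (1ℚ + h) * weight w₂ W →
    w₂ e ≤ w₁ e + two ^ suc (suc (suc (length W ℕ.+ length C))) * ((κ * δ⁻ + 1ℚ) * h)
  balanced-additive w₁ w₂ {δ} {δ⁻} {κ} {h} W e C 0<δ 0≤δ⁻ δδ⁻≡1 0≤κ 0≤h g≤1 onW onC δ≤e e≤2 bal₁ bal₂ =
    begin
      w₂ e                              ≤⟨ balanced-close w₁ w₂ W e C 0≤c onW′ onC′ 0<e
                                             (≤-trans bal₁ (*-monoʳ {y = 1ℚ + g} (<⇒≤ (0<* 0<e (0<weight w₁ C λ x∈ → <-≤-trans 0<δ (proj₁ (onC x∈))))) 1+h≤c))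
                                             (≤-trans bal₂ (*-monoʳ {y = 1ℚ + g} (<⇒≤ (0<weight w₂ W λ x∈ → <-≤-trans 0<δ (proj₁ (proj₂ (onW x∈))))) 1+h≤c)) ⟩
      c ^ m * w₁ e                      ≤⟨ *-monoʳ {w₁ e} {c ^ m} {1ℚ + (two ^ m - 1ℚ) * g} (<⇒≤ 0<e) ([1+x]^n≤1+[2^n-1]x m 0≤g g≤1) ⟩
      (1ℚ + (two ^ m - 1ℚ) * g) * w₁ e  ≤⟨ ≤-by {(1ℚ + (two ^ m - 1ℚ) * g) * w₁ e} (two ^ m * g * (two - w₁ e) + g * w₁ e)
                                             (0≤+ (0≤* (0≤* (≤-trans 0≤1 (1≤2^ m)) 0≤g) (≤⇒0≤- e≤2)) (0≤* 0≤g (<⇒≤ 0<e)))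
                                             (solve 4 (λ t T g u → u :+ t :* T :* g := (con 1ℚ :+ (T :- con 1ℚ) :* g) :* u :+ (T :* g :* (t :- u) :+ g :* u))
                                               refl two (two ^ m) g (w₁ e)) ⟩
      w₁ e + two * two ^ m * g          ∎
    where
    open ≤-Reasoning
    g c : ℚ
    g = (κ * δ⁻ + 1ℚ) * h
    c = 1ℚ + g
    m : ℕ
    m = suc (suc (length W ℕ.+ length C))
    0≤g : 0ℚ ≤ g
    0≤g = 0≤* (0≤+ (0≤* 0≤κ 0≤δ⁻) 0≤1) 0≤h
    0≤c : 0ℚ ≤ c
    0≤c = 0≤+ 0≤1 0≤g
    0<e : 0ℚ < w₁ e
    0<e = <-≤-trans 0<δ δ≤e
    1+h≤c : 1ℚ + h ≤ c
    1+h≤c = +-monoʳ-≤ 1ℚ (≤-by {h} (κ * δ⁻ * h) (0≤* (0≤* 0≤κ 0≤δ⁻) 0≤h)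
      (solve 2 (λ a h → (a :+ con 1ℚ) :* h := h :+ a :* h) refl (κ * δ⁻) h))
    scale : ∀ {x y} → δ ≤ x → y ≤ x + κ * h → y ≤ c * x
    scale {x} {y} δ≤x y≤ = ≤-trans y≤ (≤-by {x + κ * h} (κ * δ⁻ * h * (x - δ) + h * x)
      (0≤+ (0≤* (0≤* (0≤* 0≤κ 0≤δ⁻) 0≤h) (≤⇒0≤- δ≤x)) (0≤* 0≤h (≤-trans (<⇒≤ 0<δ) δ≤x)))
      (trans (solve 5 (λ κ δ δ⁻ h x → (con 1ℚ :+ (κ :* δ⁻ :+ con 1ℚ) :* h) :* x
          := x :+ κ :* h :* (δ :* δ⁻) :+ (κ :* δ⁻ :* h :* (x :- δ) :+ h :* x)) refl κ δ δ⁻ h x)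
        (trans (cong (λ z → x + κ * h * z + (κ * δ⁻ * h * (x - δ) + h * x)) δδ⁻≡1)
          (cong (λ z → x + z + (κ * δ⁻ * h * (x - δ) + h * x)) (*-identityʳ (κ * h))))))
    onW′ : ∀ {x} → x ∈ W → 0ℚ < w₁ x × 0ℚ < w₂ x × w₂ x ≤ c * w₁ x
    onW′ x∈ = let δ≤₁ , δ≤₂ , le = onW x∈ in <-≤-trans 0<δ δ≤₁ , <-≤-trans 0<δ δ≤₂ , scale δ≤₁ le
    onC′ : ∀ {x} → x ∈ C → 0ℚ < w₁ x × 0ℚ < w₂ x × w₁ x ≤ c * w₂ x
    onC′ x∈ = let δ≤₁ , δ≤₂ , le = onC x∈ in <-≤-trans 0<δ δ≤₁ , <-≤-trans 0<δ δ≤₂ , scale δ≤₂ le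

  -- j₀ is the column of e if that is a coordinate; otherwise e lies in the last column, and j₀ is any
  -- coordinate, as increasing it lowers the last column.
  module _ {k n : ℕ} (s : Sequence (suc k) n) (W : List (Fin (suc k) × Fin (suc k))) (e : Fin (suc k) × Fin (suc k))
    (C : List (Fin (suc k) × Fin (suc k)))
    (W⊆ : ∀ {x} → x ∈ W → x ∈ transitions s) (C⊆ : ∀ {x} → x ∈ e ∷ C → x ∈ transitions s)
    (e∉W : e ∉ W) (C-row : ∀ {x} → x ∈ C → proj₁ x ≡ proj₁ e → x ≡ e)
    (j₀ : Fin k) (choice : proj₂ e ≢ fromℕ k → proj₂ e ≡ inject₁ j₀)
    {δ δ⁻ h : ℚ} (0<δ : 0ℚ < δ) (0≤δ⁻ : 0ℚ ≤ δ⁻) (δδ⁻≡1 : δ * δ⁻ ≡ 1ℚ) (0<h : 0ℚ < h) where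

    private
      κ T γ : ℚ
      κ = fromNat (suc (suc k))
      T = two ^ suc (suc (suc (length W ℕ.+ length C)))
      γ = κ * δ⁻ + 1ℚ

      i₀ : Fin (suc k)
      i₀ = proj₁ e

    module _ (γh≤1 : γ * h ≤ 1ℚ) (Q₁ Q₂ : Fin (suc (suc k)) → Fin (suc k) → ℚ)
      (good₁ : Balanced s W (e ∷ C) δ h Q₁) (good₂ : Balanced s W (e ∷ C) δ h Q₂)
      (close : ∀ i j → ¬ (i ≡ suc i₀ × j ≡ j₀) →
        Q₁ i (inject₁ j) ≤ Q₂ i (inject₁ j) + h × Q₂ i (inject₁ j) ≤ Q₁ i (inject₁ j) + h) where

      private
        module G₁ = Balanced good₁
        module G₂ = Balanced good₂
        w₁ w₂ : Fin (suc k) × Fin (suc k) → ℚ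
        w₁ = edgeWeight Q₁
        w₂ = edgeWeight Q₂
        H D : ℚ
        H = κ * h
        D = T * (γ * h)

        0≤h : 0ℚ ≤ h
        0≤h = <⇒≤ 0<h

        h≤H : h ≤ H
        h≤H = ≤-by (fromNat (suc k) * h) (0≤* (0≤fromNat (suc k)) 0≤h)
          (solve 2 (λ k h → (con 1ℚ :+ k) :* h := h :+ k :* h) refl (fromNat (suc k)) h)

        0≤H : 0ℚ ≤ H
        0≤H = ≤-trans 0≤h h≤H

        widen : ∀ x y → x ≤ y + h → x ≤ y + H
        widen x y le = ≤-trans le (+-monoʳ-≤ y h≤H)

        -- Here Q₂ has moved mass from the last column to j₀ in row i₀.
        module _ (c : ℚ) (H≤c : H ≤ c) (moved : Q₁ (suc i₀) (inject₁ j₀) + c ≤ Q₂ (suc i₀) (inject₁ j₀)) where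

          0≤c : 0ℚ ≤ c
          0≤c = ≤-trans 0≤H H≤c

          last-moved : Q₂ (suc i₀) (fromℕ k) + c ≤ Q₁ (suc i₀) (fromℕ k) + H
          last-moved = last-shift (Q₁ (suc i₀)) (Q₂ (suc i₀)) (G₁.1≤∑ (suc i₀)) (G₂.∑≤1 (suc i₀))
            (∑-mono-at (Q₁ (suc i₀) ∘ inject₁) (Q₂ (suc i₀) ∘ inject₁) j₀ 0≤h
              (λ j j≢ → proj₁ (close (suc i₀) j (j≢ ∘ proj₂))) moved)

          -- In the other rows every coordinate is controlled, hence so is the entry fixed by the
          -- row sum.
          last-close : ∀ i → i ≢ i₀ → Q₁ (suc i) (fromℕ k) ≤ Q₂ (suc i) (fromℕ k) + H ×
            Q₂ (suc i) (fromℕ k) ≤ Q₁ (suc i) (fromℕ k) + H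
          last-close i i≢ =
            drop0 {Q₁ (suc i) (fromℕ k)} (last-shift (Q₂ (suc i)) (Q₁ (suc i)) (G₂.1≤∑ (suc i)) (G₁.∑≤1 (suc i))
              (add0 {∑ᵠ (Q₂ (suc i) ∘ inject₁)} (∑-mono-+ (Q₂ (suc i) ∘ inject₁) (Q₁ (suc i) ∘ inject₁) (λ j → proj₂ (close (suc i) j (i≢ ∘ Finₚ.suc-injective ∘ proj₁)))))) ,
            drop0 {Q₂ (suc i) (fromℕ k)} (last-shift (Q₁ (suc i)) (Q₂ (suc i)) (G₁.1≤∑ (suc i)) (G₂.∑≤1 (suc i))
              (add0 {∑ᵠ (Q₁ (suc i) ∘ inject₁)} (∑-mono-+ (Q₁ (suc i) ∘ inject₁) (Q₂ (suc i) ∘ inject₁) (λ j → proj₁ (close (suc i) j (i≢ ∘ Finₚ.suc-injective ∘ proj₁))))))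
            where
            add0 : ∀ {x y} → x ≤ y → x + 0ℚ ≤ y
            add0 {x} = ≤-trans (≤-reflexive (+-identityʳ x))
            drop0 : ∀ {x y} → x + 0ℚ ≤ y → x ≤ y
            drop0 {x} = ≤-trans (≤-reflexive (sym (+-identityʳ x)))

          -- From `Q₁` to `Q₂` only (i₀ , j₀) can rise by more than `H`, and by `down` only the last
          -- entry of row i₀ can fall by more. `balanced-additive` asks for one-sided bounds only,
          -- and these suffice.
          up : ∀ x → x ≢ (i₀ , inject₁ j₀) → w₂ x ≤ w₁ x + H
          up (i , j) x≢ with view j
          ... | ‵inject₁ j′ = widen (Q₂ (suc i) (inject₁ j′)) (Q₁ (suc i) (inject₁ j′)) (proj₂ (close (suc i) j′ λ { (refl , refl) → x≢ refl }))
          ... | ‵fromℕ with i Finₚ.≟ i₀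
          ... | no  i≢   = proj₂ (last-close i i≢)
          ... | yes refl = ≤-trans (≤-by {w₂ (i , fromℕ k)} c 0≤c refl) last-moved

          down : ∀ x → x ≢ (i₀ , fromℕ k) → w₁ x ≤ w₂ x + H
          down (i , j) x≢ with view j
          down (i , j) x≢ | ‵fromℕ = proj₁ (last-close i λ { refl → x≢ refl })
          down (i , j) x≢ | ‵inject₁ j′ with (i Finₚ.≟ i₀) | (j′ Finₚ.≟ j₀)
          ... | yes refl | yes refl = ≤-trans (≤-by {w₁ (i , inject₁ j₀)} c 0≤c refl) (≤-trans moved (≤-by {w₂ (i , inject₁ j₀)} H 0≤H refl))
          ... | yes refl | no j≢    = widen (Q₁ (suc i) (inject₁ j′)) (Q₂ (suc i) (inject₁ j′)) (proj₁ (close (suc i) j′ (j≢ ∘ proj₂)))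
          ... | no i≢    | _        = widen (Q₁ (suc i) (inject₁ j′)) (Q₂ (suc i) (inject₁ j′)) (proj₁ (close (suc i) j′ (i≢ ∘ Finₚ.suc-injective ∘ proj₁)))

          C∌ : ∀ {x y} → x ∈ C → y ≢ e → proj₁ y ≡ i₀ → x ≢ y
          C∌ x∈ y≢e y-row refl = y≢e (C-row x∈ y-row)

          -- `e` is one of the two entries that move. If it is (i₀ , j₀), the tie limits its rise
          -- directly. If it is the last entry of the row, the tie limits its fall, and `last-moved`
          -- passes the limit on to `c` at the cost of `H`.
          bound : c ≤ H + D
          bound with proj₂ e Finₚ.≟ fromℕ k
          ... | no e≢last = ≤-by (q₁ + D - (q₁ + c) + H) (0≤+ (≤⇒0≤- (≤-trans moved q₂≤)) 0≤H)
              (solve 4 (λ q H D c → H :+ D := c :+ (q :+ D :- (q :+ c) :+ H)) refl q₁ H D c)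
            where
            q₁ : ℚ
            q₁ = Q₁ (suc i₀) (inject₁ j₀)
            e≡ : e ≡ (i₀ , inject₁ j₀)
            e≡ = cong (i₀ ,_) (choice e≢last)
            q₂≤ : Q₂ (suc i₀) (inject₁ j₀) ≤ q₁ + D
            q₂≤ = subst (λ x → w₂ x ≤ w₁ x + D) e≡
              (balanced-additive w₁ w₂ W e C 0<δ 0≤δ⁻ δδ⁻≡1 (0≤fromNat (suc (suc k))) 0≤h γh≤1
                (λ {x} x∈ → G₁.δ≤ (W⊆ x∈) , G₂.δ≤ (W⊆ x∈) , up x (λ x≡ → e∉W (subst (_∈ W) (trans x≡ (sym e≡)) x∈)))
                (λ {x} x∈ → G₁.δ≤ (C⊆ (there x∈)) , G₂.δ≤ (C⊆ (there x∈)) , down x (C∌ x∈ (e≢last ∘ sym ∘ cong proj₂) refl))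
                (G₁.δ≤ (C⊆ (here refl))) (G₁.Q≤2 (suc i₀) (proj₂ e)) G₁.W≤C G₂.C≤W)
          -- The roles of `Q₁` and `Q₂` are exchanged, because `e` now grows from `Q₂` to `Q₁`.
          ... | yes e≡last = ≤-by ((l₂ + D - l₁) + (l₁ + H - (l₂ + c))) (0≤+ (≤⇒0≤- l₁≤) (≤⇒0≤- last-moved))
              (solve 5 (λ a b H D c → H :+ D := c :+ ((b :+ D :- a) :+ (a :+ H :- (b :+ c)))) refl l₁ l₂ H D c)
            where
            l₁ l₂ : ℚ
            l₁ = Q₁ (suc i₀) (fromℕ k)
            l₂ = Q₂ (suc i₀) (fromℕ k)
            e≡ : e ≡ (i₀ , fromℕ k)
            e≡ = cong (i₀ ,_) e≡last
            l₁≤ : l₁ ≤ l₂ + D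
            l₁≤ = subst (λ x → w₁ x ≤ w₂ x + D) e≡
              (balanced-additive w₂ w₁ W e C 0<δ 0≤δ⁻ δδ⁻≡1 (0≤fromNat (suc (suc k))) 0≤h γh≤1
                (λ {x} x∈ → G₂.δ≤ (W⊆ x∈) , G₁.δ≤ (W⊆ x∈) , down x (λ x≡ → e∉W (subst (_∈ W) (trans x≡ (sym e≡)) x∈)))
                (λ {x} x∈ → G₂.δ≤ (C⊆ (there x∈)) , G₁.δ≤ (C⊆ (there x∈)) ,
                  up x (C∌ x∈ (λ eq → Finₚ.fromℕ≢inject₁ (trans (sym e≡last) (cong proj₂ (sym eq)))) refl))
                (G₂.δ≤ (C⊆ (here refl))) (G₂.Q≤2 (suc i₀) (proj₂ e)) G₂.W≤C G₁.C≤W)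

      balanced-graph : Q₂ (suc i₀) (inject₁ j₀) ≤ Q₁ (suc i₀) (inject₁ j₀) + (κ + T * γ + 1ℚ) * h
      balanced-graph with Q₂ (suc i₀) (inject₁ j₀) ≤? Q₁ (suc i₀) (inject₁ j₀) + (κ + T * γ + 1ℚ) * h
      ... | yes le = le
      ... | no ¬le = contradiction (bound c H≤c (<⇒≤ (≰⇒> ¬le))) (λ c≤ → <-irrefl refl (<-≤-trans H+D<c c≤))
        where
        c : ℚ
        -- `H + D` from `bound`, plus one `h` to make the contradiction strict.
        c = (κ + T * γ + 1ℚ) * h
        c≡ : c ≡ H + D + h
        c≡ = solve 4 (λ κ T γ h → (κ :+ T :* γ :+ con 1ℚ) :* h := κ :* h :+ T :* (γ :* h) :+ h) refl κ T γ h
        0≤D : 0ℚ ≤ D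
        0≤D = 0≤* (≤-trans 0≤1 (1≤2^ (suc (suc (suc (length W ℕ.+ length C))))))
          (0≤* (0≤+ (0≤* (0≤fromNat (suc (suc k))) 0≤δ⁻) 0≤1) 0≤h)
        H≤c : H ≤ c
        H≤c = ≤-by (D + h) (0≤+ 0≤D 0≤h) (trans c≡ (+-assoc H D h))
        H+D<c : H + D < c
        H+D<c = ≤-<-trans (≤-reflexive (sym (+-identityʳ (H + D)))) (<-≤-trans (+-monoʳ-< (H + D) 0<h) (≤-reflexive (sym c≡)))

  -- Constants, and nullity of the region of a tie

  ½*< : ∀ {x} → 0ℚ < x → ½ * x < x
  ½*< {x} 0<x = ≤-<-trans (≤-reflexive (sym (+-identityʳ (½ * x))))
    (<-≤-trans (+-monoʳ-< (½ * x) (½*-pos 0<x)) (≤-reflexive (½+½ x)))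

  small-η : ∀ {ρ σ δ h} → 0ℚ < ρ → 0ℚ < σ → 0ℚ < δ → 0ℚ < h →
    ∃[ η ] (0ℚ < η × η < ρ × η ≤ σ × η < δ × η ≤ h × η ≤ h * σ)
  small-η {ρ} {σ} {δ} {h} 0<ρ 0<σ 0<δ 0<h
    with 0<min (½*-pos 0<ρ) (½*-pos 0<δ) | 0<min 0<h (0<* 0<h 0<σ)
  ... | a , 0<a , a≤ρ , a≤δ | b , 0<b , b≤h , b≤hσ with 0<min 0<a 0<b
  ... | c , 0<c , c≤a , c≤b with 0<min 0<c 0<σ
  ... | η , 0<η , η≤c , η≤σ = η , 0<η ,
    ≤-<-trans (≤-trans η≤c (≤-trans c≤a a≤ρ)) (½*< 0<ρ) , η≤σ ,
    ≤-<-trans (≤-trans η≤c (≤-trans c≤a a≤δ)) (½*< 0<δ) ,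
    ≤-trans η≤c (≤-trans c≤b b≤h) , ≤-trans η≤c (≤-trans c≤b b≤hσ)

  -- These depend on the numbers of states and transitions alone and are fixed before `h`, and η is
  -- fixed after `h`; thus `K`, which is built from `δ⁻`, serves all scales.
  record Constants (k n : ℕ) : Set where
    field
      ρ σ δ δ⁻ : ℚ
      0<ρ      : 0ℚ < ρ
      0<σ      : 0ℚ < σ
      0<δ      : 0ℚ < δ
      0≤δ⁻     : 0ℚ ≤ δ⁻
      kρ≡1     : fromNat (suc k) * ρ ≡ 1ℚ
      σ+σ≡     : σ + σ ≡ ρ ^ suc n
      δ≡       : two ^ suc n * δ ≡ σ
      δδ⁻≡1    : δ * δ⁻ ≡ 1ℚ

  constants : ∀ k n → Constants k n
  constants k n = conclude (reciprocal (0<fromNat k)) (reciprocal (0<^ (suc n) 0<two))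
    where
    D : ℚ
    D = two ^ suc n
    conclude : ∃[ ρ ] (0ℚ < ρ × fromNat (suc k) * ρ ≡ 1ℚ) → ∃[ D⁻ ] (0ℚ < D⁻ × D * D⁻ ≡ 1ℚ) → Constants k n
    conclude (ρ , 0<ρ , kρ≡1) (D⁻ , 0<D⁻ , DD⁻≡1) = record
      { ρ = ρ ; σ = σ ; δ = D⁻ * σ ; δ⁻ = proj₁ (reciprocal 0<δ) ; 0<ρ = 0<ρ ; 0<σ = 0<σ ; 0<δ = 0<δ
      ; 0≤δ⁻  = <⇒≤ (proj₁ (proj₂ (reciprocal 0<δ)))
      ; kρ≡1  = kρ≡1
      ; σ+σ≡  = ½+½ (ρ ^ suc n)
      ; δ≡    = trans (sym (*-assoc D D⁻ σ)) (trans (cong (_* σ) DD⁻≡1) (*-identityˡ σ))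
      ; δδ⁻≡1 = proj₂ (proj₂ (reciprocal 0<δ))
      }
      where
      σ : ℚ
      σ = ½ * ρ ^ suc n
      0<σ : 0ℚ < σ
      0<σ = ½*-pos (0<^ (suc n) 0<ρ)
      0<δ : 0ℚ < D⁻ * σ
      0<δ = 0<* 0<D⁻ 0<σ

  -- Two distinct transitions exclude a single state, for which the space of chains is a point and
  -- no coordinate exists.
  free-column : ∀ {k} (x e : Fin (suc k) × Fin (suc k)) → x ≢ e → ∃[ j₀ ] (proj₂ e ≢ fromℕ k → proj₂ e ≡ inject₁ j₀)
  free-column {zero}  (zero , zero) (zero , zero) x≢e = contradiction refl x≢e
  free-column {suc k} x (i , j) x≢e with view j
  ... | ‵inject₁ j′ = j′ , λ _ → refl
  ... | ‵fromℕ      = zero , λ j≢last → contradiction refl j≢last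

  module _ {k n : ℕ} (s s₁ s₂ : Sequence (suc k) n) (s₁0≡ : s₁ zero ≡ s zero) (s₂0≡ : s₂ zero ≡ s zero)
    {R W C : List (Fin (suc k) × Fin (suc k))} {e : Fin (suc k) × Fin (suc k)}
    (s↭ : transitions s ↭ R ++ W ++ (e ∷ C)) (s₁↭ : transitions s₁ ↭ R ++ (e ∷ C) ++ (e ∷ C))
    (s₂↭ : transitions s₂ ↭ R ++ W ++ W)
    (e∉W : e ∉ W) (C-row : ∀ {x} → x ∈ C → proj₁ x ≡ proj₁ e → x ≡ e) where

    private
      i₀ : Fin (suc (suc k))
      i₀ = suc (proj₁ e)

      W⊆ : ∀ {x} → x ∈ W → x ∈ transitions s
      W⊆ = ∈-resp-↭ (↭-sym s↭) ∘ ∈-++⁺ʳ R ∘ ∈-++⁺ˡ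

      C⊆ : ∀ {x} → x ∈ e ∷ C → x ∈ transitions s
      C⊆ = ∈-resp-↭ (↭-sym s↭) ∘ ∈-++⁺ʳ R ∘ ∈-++⁺ʳ W

      open Constants (constants (suc k) n)

      κ T γ K : ℚ
      κ = fromNat (suc (suc k))
      T = two ^ suc (suc (suc (length W ℕ.+ length C)))
      γ = κ * δ⁻ + 1ℚ
      K = κ + T * γ + 1ℚ

      0<γ : 0ℚ < γ
      0<γ = +-mono-≤-< (0≤* (0≤fromNat (suc (suc k))) 0≤δ⁻) 0<1

      0≤K : 0ℚ ≤ K
      0≤K = 0≤+ (0≤+ (0≤fromNat (suc (suc k))) (0≤* (≤-trans 0≤1 (1≤2^ (suc (suc (suc (length W ℕ.+ length C)))))) (<⇒≤ 0<γ))) 0≤1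

      module _ (j₀ : Fin k) (choice : proj₂ e ≢ fromℕ k → proj₂ e ≡ inject₁ j₀) (M : MarkovChain (suc k)) (best : IsViterbiPath M s) where

        Region : ℝ^ (suc (suc k)) k → Set
        Region x = ∃[ M′ ] (SameRegion {suc k} n M M′ × (∀ i j → x i j ≈ᴿ coordinates M′ i j))

        coordinates≡entry : ∀ (M′ : MarkovChain (suc k)) i j → coordinates M′ i j ≡ entry M′ i (inject₁ j)
        coordinates≡entry M′ zero    j = refl
        coordinates≡entry M′ (suc i) j = refl

        -- h₀ = 1 / γ, since the chord bound needs a relative error `γ * h` of at most 1.
        approximation : ∀ {h₀} → γ * h₀ ≡ 1ℚ → ∀ h → 0ℚ < h → h ≤ h₀ → Approximation Region i₀ j₀ K h
        approximation {h₀} γh₀≡1 h 0<h h≤h₀ = record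
          { Near    = Near
          ; approx  = λ x x∈ ¬near → ¬near (near-point x x∈ (small-η 0<ρ 0<σ 0<δ 0<h))
          ; bounded = bnd
          ; graph   = grph
          }
          where
          -- The whole matrix `Q` is kept behind the coordinates `q`: the tie may involve the last
          -- column, which `q` lacks.
          Near : (Fin (suc (suc k)) → Fin k → ℚ) → Set
          Near q = ∃[ Q ] (Balanced s W (e ∷ C) δ h Q × (∀ i j → q i j ≡ Q i (inject₁ j)))
          bnd : ∀ q → Near q → ∀ i j → - 1ℚ ≤ q i j × q i j ≤ two
          bnd q (Q , good , q≡) i j = subst (λ z → - 1ℚ ≤ z × z ≤ two) (sym (q≡ i j))
            (Balanced.-1≤Q good i (inject₁ j) , Balanced.Q≤2 good i (inject₁ j))
          grph : ∀ q q′ → Near q → Near q′ →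
                (∀ i j → ¬ (i ≡ i₀ × j ≡ j₀) → q i j ≤ q′ i j + h × q′ i j ≤ q i j + h) →
                q i₀ j₀ ≤ q′ i₀ j₀ + K * h
          grph q q′ (Q , good , q≡) (Q′ , good′ , q′≡) close = subst (λ z → z ≤ q′ i₀ j₀ + K * h) (sym (q≡ i₀ j₀))
            (subst (λ z → Q i₀ (inject₁ j₀) ≤ z + K * h) (sym (q′≡ i₀ j₀))
              (balanced-graph s W e C W⊆ C⊆ e∉W C-row j₀ choice 0<δ 0≤δ⁻ δδ⁻≡1 0<h
                (≤-trans (*-monoˡ (<⇒≤ 0<γ) h≤h₀) (≤-reflexive γh₀≡1)) Q′ Q good′ good
                λ i j ¬s → subst (λ z → z ≤ Q i (inject₁ j) + h × Q i (inject₁ j) ≤ z + h) (q′≡ i j)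
                  (subst (λ z → q′ i j ≤ z + h × z ≤ q′ i j + h) (q≡ i j) (proj₂ (close i j ¬s) , proj₁ (close i j ¬s)))))
          near-point : ∀ x → Region x → ∃[ η ] (0ℚ < η × η < ρ × η ≤ σ × η < δ × η ≤ h × η ≤ h * σ) →
            ∃[ q ] (Near q × Close h x q)
          near-point x (M′ , same , x≈) (η , 0<η , η<ρ , η≤σ , η<δ , η≤h , η≤hσ) =
            from-stage (stage-almostViterbi M′ s (Equivalence.to (same s) best) 0<η)
            where
            from-stage : ∃[ t ] (AlmostViterbi s η (stage M′ t) × Close η (entry M′) (stage M′ t)) → ∃[ q ] (Near q × Close h x q)
            from-stage (t , av , close) = (λ i j → stage M′ t i (inject₁ j)) ,
              (stage M′ t , almostViterbi⇒balanced s (stage M′ t) 0<ρ 0<σ 0<δ 0<η 0<h kρ≡1 σ+σ≡ δ≡ η<ρ η≤σ η<δ η≤h η≤hσ av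
                s↭ s₁ s₂ s₁0≡ s₂0≡ s₁↭ s₂↭ , λ _ _ → refl) ,
              λ i j → let q = stage M′ t i (inject₁ j)
                          y = entry M′ i (inject₁ j)
                          x≈y = subst (x i j ≈ᴿ_) (coordinates≡entry M′ i j) (x≈ i j)
                          q≤y , y≤q = close i (inject₁ j) in
                ≤ᴿ-trans (fromℚ (q - h)) y (x i j) (fromℚ-≤ᴿ {q = q - η} {x = y} (+-monoʳ-≤ q (neg-antimono-≤ η≤h)) q≤y) (proj₂ x≈y) ,
                ≤ᴿ-trans (x i j) y (fromℚ (q + h)) (proj₁ x≈y) (≤ᴿ-fromℚ {p = q + η} {x = y} (+-monoʳ-≤ q η≤h) y≤q)

        null-region : ¬ PositiveMeasure Region
        null-region = conclude (reciprocal 0<γ)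
          where
          conclude : ∃[ h₀ ] (0ℚ < h₀ × γ * h₀ ≡ 1ℚ) → ¬ PositiveMeasure Region
          conclude (h₀ , 0<h₀ , γh₀≡1) = thin⇒¬positive Region i₀ j₀ K 0≤K 0<h₀ (approximation γh₀≡1)

    -- A surplus transition `e` in C makes the region null. The surplus `x` in W differs from `e`
    -- and so guarantees a coordinate to move.
    no-tie : ∀ {x} → x ∈ W → ¬ IsViterbiSequence s
    no-tie {x} x∈W (M , positive , best) with free-column x e (λ { refl → e∉W x∈W })
    ... | j₀ , choice = null-region j₀ choice M best positive

open import Data.Nat.Base using (ℕ; zero; suc; _+_; _*_; _∸_; _≤_; _<_; z≤n; s≤s; NonZero; >-nonZero⁻¹)
open import Data.Nat.DivMod using (_%_; _mod_; %-distribˡ-+; [m+kn]%n≡m%n; m%n%n≡m%n; m%n<n; m<n⇒m%n≡m)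
open import Data.Nat.Properties

-- Walks

private
  variable
    V U : Set
    k n : ℕ

-- Loops are exchanged by splicing lists of transitions; a walk certifies that a spliced list comes
-- from a sequence of states.
data Walk {V : Set} : V → List (V × V) → V → Set where
  []  : ∀ {i} → Walk i [] i
  _∷_ : ∀ i {j es l} → Walk j es l → Walk i ((i , j) ∷ es) l

infixr 5 _++ʷ_

_++ʷ_ : ∀ {i j l : V} {xs ys} → Walk i xs j → Walk j ys l → Walk i (xs ++ ys) l
[]       ++ʷ w = w
(i ∷ v) ++ʷ w = i ∷ (v ++ʷ w)

walk⇒sequence : ∀ {i l : Fin k} {es} → Walk i es l → length es ≡ n →
  Σ[ s ∈ Sequence k n ] (s zero ≡ i × transitions s ≡ es)
walk⇒sequence {i = i} []      refl = (λ _ → i) , refl , refl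
walk⇒sequence {n = suc n} (i ∷ w) eq with walk⇒sequence {n = n} w (suc-injective eq)
... | s , refl , refl = (λ { zero → i ; (suc t) → s t }) , refl , refl

-- Natural-number positions allow sums as indices. Past the end the last state is repeated.
extend : (Fin (suc n) → V) → ℕ → V
extend             s zero    = s zero
extend {n = zero}  s (suc t) = s zero
extend {n = suc n} s (suc t) = extend (s ∘ suc) t

extend-toℕ : ∀ (s : Fin (suc n) → V) t → extend s (toℕ t) ≡ s t
extend-toℕ             s zero    = refl
extend-toℕ {n = suc n} s (suc t) = extend-toℕ (s ∘ suc) t

segment : (ℕ → V) → ℕ → ℕ → List (V × V)
segment f l zero    = []
segment f l (suc m) = (f l , f (suc l)) ∷ segment f (suc l) m

segment-++ : ∀ (f : ℕ → V) l m {m′} → segment f l (m + m′) ≡ segment f l m ++ segment f (l + m) m′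
segment-++ f l zero    {m′} = cong (λ l → segment f l m′) (sym (+-identityʳ l))
segment-++ f l (suc m) {m′} = cong ((f l , f (suc l)) ∷_)
  (trans (segment-++ f (suc l) m) (cong (λ x → segment f (suc l) m ++ segment f x m′) (sym (+-suc l m))))

length-segment : ∀ (f : ℕ → V) l m → length (segment f l m) ≡ m
length-segment f l zero    = refl
length-segment f l (suc m) = cong suc (length-segment f (suc l) m)

segment-walk : ∀ (f : ℕ → V) l m → Walk (f l) (segment f l m) (f (l + m))
segment-walk f l zero    = subst (Walk (f l) [] ∘ f) (sym (+-identityʳ l)) []
segment-walk f l (suc m) = f l ∷ subst (Walk (f (suc l)) (segment f (suc l) m) ∘ f) (sym (+-suc l m)) (segment-walk f (suc l) m)

segment-suc : ∀ (f : ℕ → V) l m → segment (f ∘ suc) l m ≡ segment f (suc l) m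
segment-suc f l zero    = refl
segment-suc f l (suc m) = cong (_ ∷_) (segment-suc f (suc l) m)

transitions-segment : ∀ (s : Sequence k n) → transitions s ≡ segment (extend s) 0 n
transitions-segment {n = zero}  s = refl
transitions-segment {n = suc n} s = cong₂ (λ j es → (s zero , j) ∷ es) (sym (extend-toℕ s (suc zero)))
  (trans (transitions-segment (s ∘ suc)) (segment-suc (extend s) 0 n))

-- With `interior⁺`, translates between the positional condition of `Decomposition` and a condition
-- on the middle block of a concatenation.
interior⁻ : ∀ {Q : U → Set} (g : Fin n → U) P I {S} → tabulate g ≡ P ++ I ++ S →
  (∀ t → length P ≤ toℕ t → toℕ t < length P + length I → Q (g t)) → All Q I
interior⁻ g [] [] eq q = []
interior⁻ {n = suc n} {Q = Q} g [] (x ∷ I) eq q = subst Q (∷-injectiveˡ eq) (q zero z≤n (s≤s z≤n)) ∷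
  interior⁻ (g ∘ suc) [] I (∷-injectiveʳ eq) (λ t _ t< → q (suc t) z≤n (s≤s t<))
interior⁻ {n = suc n} g (x ∷ P) I eq q =
  interior⁻ (g ∘ suc) P I (∷-injectiveʳ eq) (λ t ≤t t< → q (suc t) (s≤s ≤t) (s≤s t<))

interior⁺ : ∀ {Q : U → Set} (g : Fin n → U) P I {S} → tabulate g ≡ P ++ I ++ S → All Q I →
  ∀ t → length P ≤ toℕ t → toℕ t < length P + length I → Q (g t)
interior⁺ {n = suc n} {Q = Q} g [] (x ∷ I) eq (qx ∷ qI) zero    _ _ = subst Q (sym (∷-injectiveˡ eq)) qx
interior⁺ {n = suc n} g [] (x ∷ I) eq (qx ∷ qI) (suc t) _ (s≤s t<) = interior⁺ (g ∘ suc) [] I (∷-injectiveʳ eq) qI t z≤n t<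
interior⁺ {n = suc n} g (x ∷ P) I eq qI (suc t) (s≤s ≤t) (s≤s t<) =
  interior⁺ (g ∘ suc) P I (∷-injectiveʳ eq) qI t ≤t t<

module _ {q : ℕ} .{{_ : NonZero q}} (c : Fin q → Fin k) (c-injective : Injective _≡_ _≡_ c) where

  cycleTransition-deterministic : ∀ {e e′} → CycleTransition c e → CycleTransition c e′ →
    proj₁ e ≡ proj₁ e′ → e ≡ e′
  cycleTransition-deterministic (i , refl) (j , refl) ci≡cj with c-injective ci≡cj
  ... | refl = refl

  private
    suc-mod : ∀ m → suc (toℕ (m mod q)) mod q ≡ suc m mod q
    suc-mod m = Finₚ.toℕ-injective (begin
      toℕ (suc (toℕ (m mod q)) mod q)    ≡⟨ toℕ-mod (suc (toℕ (m mod q))) ⟩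
      suc (toℕ (m mod q)) % q            ≡⟨ cong (λ x → suc x % q) (toℕ-mod m) ⟩
      suc (m % q) % q                    ≡⟨ %-distribˡ-+ 1 (m % q) q ⟩
      (1 % q + m % q % q) % q            ≡⟨ cong (λ x → (1 % q + x) % q) (m%n%n≡m%n m q) ⟩
      (1 % q + m % q) % q                ≡⟨ %-distribˡ-+ 1 m q ⟨
      suc m % q                          ≡⟨ toℕ-mod (suc m) ⟨
      toℕ (suc m mod q)                  ∎)
      where
      open ≡-Reasoning
      toℕ-mod : ∀ m → toℕ (m mod q) ≡ m % q
      toℕ-mod m = Finₚ.toℕ-fromℕ< (m%n<n m q)

    walk-along : ∀ {i es l} → Walk i es l → All (CycleTransition c) es → ∀ m → i ≡ c (m mod q) →
      l ≡ c ((m + length es) mod q)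
    walk-along [] [] m eq = trans eq (cong (λ x → c (x mod q)) (sym (+-identityʳ m)))
    walk-along {es = _ ∷ es} (i ∷ w) ((j , refl) ∷ all) m eq with c-injective eq
    ... | refl = trans (walk-along w all (suc m) (cong c (suc-mod m))) (cong (λ x → c (x mod q)) (sym (+-suc m (length es))))

  -- The first transition fixes the phase on the cycle, distinctness of the states forces each
  -- further one to advance it by one, and a multiple of `q` steps restores it modulo `q`.
  walk-closed : ∀ {i es l} → Walk i es l → All (CycleTransition c) es → ∀ m → length es ≡ m * q → l ≡ i
  walk-closed [] _ _ _ = refl
  walk-closed {es = _ ∷ es} w@(_ ∷ _) all@((j , refl) ∷ _) m eq =
    trans (walk-along w all (toℕ j) j≡) (trans (cong c (Finₚ.toℕ-injective (begin
      toℕ ((toℕ j + suc (length es)) mod q) ≡⟨ Finₚ.toℕ-fromℕ< (m%n<n (toℕ j + suc (length es)) q) ⟩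
      (toℕ j + suc (length es)) % q         ≡⟨ cong (λ x → (toℕ j + x) % q) eq ⟩
      (toℕ j + m * q) % q                   ≡⟨ [m+kn]%n≡m%n (toℕ j) m q ⟩
      toℕ j % q                             ≡⟨ Finₚ.toℕ-fromℕ< (m%n<n (toℕ j) q) ⟨
      toℕ (toℕ j mod q)                     ∎))) (sym j≡))
    where
    open ≡-Reasoning
    j≡ : c j ≡ c (toℕ j mod q)
    j≡ = cong c (Finₚ.toℕ-injective (sym (trans (Finₚ.toℕ-fromℕ< (m%n<n (toℕ j) q)) (m<n⇒m%n≡m (Finₚ.toℕ<n j)))))

-- Exchanging loops

module ↭-Solver {A : Set} = CommutativeMonoidSolver (++-commutativeMonoid {A = A})

Edge : ℕ → Set
Edge k = Fin k × Fin k

-- The one property of cycle turns on which the tie argument depends.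
Deterministic : ∀ {k} → List (Edge k) → Set
Deterministic C = ∀ {x y} → x ∈ C → y ∈ C → proj₁ x ≡ proj₁ y → x ≡ y

-- Equal lengths leave the surpluses of W and C both empty or both non-empty, and the second case is
-- excluded by `no-tie`.
tied-↭ : ∀ {k n} (s s₁ s₂ : Sequence (suc k) n) → IsViterbiSequence s → s₁ zero ≡ s zero → s₂ zero ≡ s zero →
  ∀ {R W C} → transitions s ↭ R ++ W ++ C → transitions s₁ ↭ R ++ C ++ C → transitions s₂ ↭ R ++ W ++ W →
  length W ≡ length C → Deterministic C → W ↭ C
tied-↭ s s₁ s₂ viterbi s₁0≡ s₂0≡ {R} {W} {C} s↭ s₁↭ s₂↭ ∣W∣≡∣C∣ det
  with cancel-common (≡-dec Finₚ._≟_ Finₚ._≟_) W C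
... | Z , W′ , C′ , W↭ , C↭ , disjoint = conclude W′ C′ W↭ C↭ disjoint ∣W′∣≡∣C′∣
  where
  ∣W′∣≡∣C′∣ : length W′ ≡ length C′
  ∣W′∣≡∣C′∣ = +-cancelˡ-≡ (length Z) (length W′) (length C′) (begin
    length Z + length W′  ≡⟨ length-++ Z ⟨
    length (Z ++ W′)      ≡⟨ ↭-length W↭ ⟨
    length W              ≡⟨ ∣W∣≡∣C∣ ⟩
    length C              ≡⟨ ↭-length C↭ ⟩
    length (Z ++ C′)      ≡⟨ length-++ Z ⟩
    length Z + length C′  ∎)
    where open ≡-Reasoning
  -- Each of the two blocks contributes one copy of Z, so `s`, `s₁` and `s₂` all have the common
  -- rest R ++ Z ++ Z.
  regroup : ∀ {X Y X′ Y′} → X ↭ Z ++ X′ → Y ↭ Z ++ Y′ → R ++ X ++ Y ↭ (R ++ Z ++ Z) ++ X′ ++ Y′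
  regroup {X′ = X′} {Y′} X↭ Y↭ = ↭-trans (++⁺ˡ R (++⁺ X↭ Y↭))
    (solve 4 (λ r z x y → r ⊕ ((z ⊕ x) ⊕ (z ⊕ y)) ⊜ (r ⊕ (z ⊕ z)) ⊕ (x ⊕ y)) ↭-refl R Z X′ Y′)
    where open ↭-Solver
  conclude : ∀ W′ C′ → W ↭ Z ++ W′ → C ↭ Z ++ C′ → (∀ {y} → y ∈ C′ → ¬ (y ∈ W′)) → length W′ ≡ length C′ → W ↭ C
  conclude []       []       W↭ C↭ _        _  = ↭-trans W↭ (↭-sym C↭)
  conclude (x ∷ W″) (e ∷ C″) W↭ C↭ disjoint _  = contradiction viterbi
    (no-tie s s₁ s₂ s₁0≡ s₂0≡ {C = C″} (↭-trans s↭ (regroup W↭ C↭)) (↭-trans s₁↭ (regroup C↭ C↭)) (↭-trans s₂↭ (regroup W↭ W↭))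
      (disjoint (here refl)) (λ x∈ → det (∈C (there x∈)) (∈C (here refl))) (here refl))
    where
    ∈C : ∀ {y} → y ∈ e ∷ C″ → y ∈ C
    ∈C = ∈-resp-↭ (↭-sym C↭) ∘ ∈-++⁺ʳ Z

-- X and Y are loops of equal length, so either may be dropped and the other run twice. In the
-- prefix argument Y is made of cycle turns, in the suffix argument X; the setting is neutral
-- between the two.
module Exchange {k n : ℕ} (s : Sequence (suc k) n) (viterbi : IsViterbiSequence s)
  {A X B Y S : List (Edge (suc k))} {u v l : Fin (suc k)} (s≡ : transitions s ≡ A ++ X ++ B ++ Y ++ S)
  (wA : Walk (s zero) A u) (wX : Walk u X u) (wB : Walk u B v) (wY : Walk v Y v) (wS : Walk v S l)
  (∣X∣≡∣Y∣ : length X ≡ length Y) where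

  private
    R : List (Edge (suc k))
    R = A ++ B ++ S

    s↭ : transitions s ↭ R ++ X ++ Y
    s↭ = ↭-trans (↭-reflexive s≡)
      (solve 5 (λ a x b y s → a ⊕ (x ⊕ (b ⊕ (y ⊕ s))) ⊜ (a ⊕ (b ⊕ s)) ⊕ (x ⊕ y)) ↭-refl A X B Y S)
      where open ↭-Solver

    same-length : ∀ {E} Z → E ↭ R ++ Z ++ Z → length X ≡ length Z → length Y ≡ length Z → length E ≡ n
    same-length {E} Z E↭ ∣X∣≡ ∣Y∣≡ = begin
      length E                          ≡⟨ ↭-length E↭ ⟩
      length (R ++ Z ++ Z)              ≡⟨ length-++ R ⟩
      length R + length (Z ++ Z)        ≡⟨ cong (length R +_) (length-++ Z) ⟩
      length R + (length Z + length Z)  ≡⟨ cong₂ (λ x y → length R + (x + y)) ∣X∣≡ ∣Y∣≡ ⟨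
      length R + (length X + length Y)  ≡⟨ cong (length R +_) (length-++ X) ⟨
      length R + length (X ++ Y)        ≡⟨ length-++ R ⟨
      length (R ++ X ++ Y)              ≡⟨ ↭-length s↭ ⟨
      length (transitions s)            ≡⟨ length-tabulate (transition s) ⟩
      n                                 ∎
      where open ≡-Reasoning

    YY↭ : A ++ B ++ Y ++ Y ++ S ↭ R ++ Y ++ Y
    YY↭ = solve 4 (λ a b y s → a ⊕ (b ⊕ (y ⊕ (y ⊕ s))) ⊜ (a ⊕ (b ⊕ s)) ⊕ (y ⊕ y)) ↭-refl A B Y S
      where open ↭-Solver

    XX↭ : A ++ X ++ X ++ B ++ S ↭ R ++ X ++ X
    XX↭ = solve 4 (λ a x b s → a ⊕ (x ⊕ (x ⊕ (b ⊕ s))) ⊜ (a ⊕ (b ⊕ s)) ⊕ (x ⊕ x)) ↭-refl A X B S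
      where open ↭-Solver

  doubleY : Σ[ s₁ ∈ Sequence (suc k) n ] (s₁ zero ≡ s zero × transitions s₁ ≡ A ++ B ++ Y ++ Y ++ S)
  doubleY = walk⇒sequence (wA ++ʷ wB ++ʷ wY ++ʷ wY ++ʷ wS) (same-length Y YY↭ ∣X∣≡∣Y∣ refl)

  doubleX : Σ[ s₂ ∈ Sequence (suc k) n ] (s₂ zero ≡ s zero × transitions s₂ ≡ A ++ X ++ X ++ B ++ S)
  doubleX = walk⇒sequence (wA ++ʷ wX ++ʷ wX ++ʷ wB ++ʷ wS) (same-length X XX↭ refl (sym ∣X∣≡∣Y∣))

  private
    doubleY-↭ : transitions (proj₁ doubleY) ↭ R ++ Y ++ Y
    doubleY-↭ = ↭-trans (↭-reflexive (proj₂ (proj₂ doubleY))) YY↭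

    doubleX-↭ : transitions (proj₁ doubleX) ↭ R ++ X ++ X
    doubleX-↭ = ↭-trans (↭-reflexive (proj₂ (proj₂ doubleX))) XX↭

  doubleY-equivalent : Deterministic Y → Equivalent s (proj₁ doubleY)
  doubleY-equivalent det = sym (proj₁ (proj₂ doubleY)) ,
    ↭-trans s↭ (↭-trans (++⁺ˡ R (++⁺ʳ Y X↭Y)) (↭-sym doubleY-↭))
    where
    X↭Y : X ↭ Y
    X↭Y = tied-↭ s (proj₁ doubleY) (proj₁ doubleX) viterbi (proj₁ (proj₂ doubleY)) (proj₁ (proj₂ doubleX))
      {R} s↭ doubleY-↭ doubleX-↭ ∣X∣≡∣Y∣ det

  doubleX-equivalent : Deterministic X → Equivalent s (proj₁ doubleX)
  doubleX-equivalent det = sym (proj₁ (proj₂ doubleX)) ,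
    ↭-trans s↭ (↭-trans (++⁺ˡ R (++⁺ˡ X Y↭X)) (↭-sym doubleX-↭))
    where
    Y↭X : Y ↭ X
    Y↭X = tied-↭ s (proj₁ doubleX) (proj₁ doubleY) viterbi (proj₁ (proj₂ doubleX)) (proj₁ (proj₂ doubleY))
      {R} (↭-trans s↭ (++⁺ˡ R (++-comm X Y))) doubleX-↭ doubleY-↭ (sym ∣X∣≡∣Y∣) det

-- Loops in the prefix or suffix contradict maximality

module _ {k : ℕ} {q : ℕ} .{{_ : NonZero q}} (c : Fin q → Fin (suc k)) (c-injective : Injective _≡_ _≡_ c) where

  cycle-deterministic : ∀ {C} → All (CycleTransition c) C → Deterministic C
  cycle-deterministic all x∈ y∈ = cycleTransition-deterministic c c-injective (All.lookup all x∈) (All.lookup all y∈)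

  decomposition⁻ : ∀ {n} (s : Sequence (suc k) n) P I {S a b} → transitions s ≡ P ++ I ++ S →
    length P ≡ a → length P + length I ≡ b → Decomposition c s a b → All (CycleTransition c) I
  decomposition⁻ s P I s≡ refl refl dec = interior⁻ (transition s) P I s≡ (Decomposition.interior dec)

  decomposition⁺ : ∀ {n} (s : Sequence (suc k) n) P I {S} → transitions s ≡ P ++ I ++ S →
    All (CycleTransition c) I → Decomposition c s (length P) (length P + length I)
  decomposition⁺ {n} s P I {S} s≡ all = record
    { a≤b      = m≤m+n (length P) (length I)
    ; b≤n      = subst (length P + length I ≤_) (trans (sym (trans (length-++ P) (trans (cong (length P +_) (length-++ I))
                   (sym (+-assoc (length P) (length I) (length S)))))) (trans (cong length (sym s≡)) (length-tabulate (transition s))))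
                   (m≤m+n (length P + length I) (length S))
    ; interior = interior⁺ (transition s) P I s≡ all
    }

  -- The turns Y are cut from the start of the interior. Being closed, they can be run twice in
  -- place, so dropping the prefix loop lengthens the interior by `d`. Lengths are given as sums so
  -- that `segment-++` can cut the sequence.
  no-prefix-loop : ∀ x d z v w m (s : Sequence (suc k) (x + d + z + (d + v) + w)) → IsViterbiSequence s →
    d ≡ m * q → 0 < d → extend s x ≡ extend s (x + d) →
    ¬ Arrangement c s (x + d + z) (x + d + z + (d + v))
  no-prefix-loop x d z v w m s viterbi d≡ 0<d loop arr = <⇒≱ longer (maximal (proj₁ doubleY) _ _ (doubleY-equivalent (cycle-deterministic allY)) dec)
    where
    open Arrangement arr
    f : ℕ → Fin (suc k)
    f = extend s
    a : ℕ
    a = x + d + z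
    A X B Y I S : List (Edge (suc k))
    A = segment f 0 x
    X = segment f x d
    B = segment f (x + d) z
    Y = segment f a d
    I = segment f (a + d) v
    S = segment f (a + (d + v)) w

    prefix≡ : segment f 0 a ≡ A ++ X ++ B
    prefix≡ = trans (segment-++ f 0 (x + d)) (trans (cong (_++ B) (segment-++ f 0 x)) (++-assoc A X B))

    interior≡ : segment f a (d + v) ≡ Y ++ I
    interior≡ = segment-++ f a d

    s≡₃ : transitions s ≡ segment f 0 a ++ segment f a (d + v) ++ S
    s≡₃ = trans (transitions-segment s) (trans (segment-++ f 0 (a + (d + v)))
      (trans (cong (_++ S) (segment-++ f 0 a)) (++-assoc (segment f 0 a) (segment f a (d + v)) S)))

    s≡ : transitions s ≡ A ++ X ++ B ++ Y ++ I ++ S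
    s≡ = begin
      transitions s                                  ≡⟨ s≡₃ ⟩
      segment f 0 a ++ segment f a (d + v) ++ S      ≡⟨ cong₂ (λ p i → p ++ i ++ S) prefix≡ interior≡ ⟩
      (A ++ X ++ B) ++ (Y ++ I) ++ S                 ≡⟨ ++-assoc A (X ++ B) ((Y ++ I) ++ S) ⟩
      A ++ (X ++ B) ++ (Y ++ I) ++ S                 ≡⟨ cong (A ++_) (++-assoc X B ((Y ++ I) ++ S)) ⟩
      A ++ X ++ B ++ (Y ++ I) ++ S                   ≡⟨ cong (λ l → A ++ X ++ B ++ l) (++-assoc Y I S) ⟩
      A ++ X ++ B ++ Y ++ I ++ S                     ∎
      where open ≡-Reasoning

    allYI : All (CycleTransition c) (Y ++ I)
    allYI = subst (All (CycleTransition c)) interior≡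
      (decomposition⁻ s (segment f 0 a) (segment f a (d + v)) s≡₃ (length-segment f 0 a)
        (cong₂ _+_ (length-segment f 0 a) (length-segment f a (d + v))) decomposition)

    allY : All (CycleTransition c) Y
    allY = Allₚ.++⁻ˡ Y allYI

    closed : f (a + d) ≡ f a
    closed = walk-closed c c-injective (segment-walk f a d) allY m (trans (length-segment f a d) d≡)

    open Exchange s viterbi s≡ (segment-walk f 0 x)
      (subst (Walk (f x) X) (sym loop) (segment-walk f x d))
      (subst (λ u → Walk u B (f a)) (sym loop) (segment-walk f (x + d) z))
      (subst (Walk (f a) Y) closed (segment-walk f a d))
      (subst (λ u → Walk u I (f (a + d + v))) closed (segment-walk f (a + d) v) ++ʷ
        subst (λ u → Walk (f u) S (f (a + (d + v) + w))) (sym (+-assoc a d v)) (segment-walk f (a + (d + v)) w))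
      (trans (length-segment f x d) (sym (length-segment f a d)))

    s₁≡ : transitions (proj₁ doubleY) ≡ (A ++ B) ++ (Y ++ Y ++ I) ++ S
    s₁≡ = trans (proj₂ (proj₂ doubleY)) (sym (trans (++-assoc A B ((Y ++ Y ++ I) ++ S))
      (cong (λ l → A ++ B ++ l) (trans (++-assoc Y (Y ++ I) S) (cong (Y ++_) (++-assoc Y I S))))))

    dec : Decomposition c (proj₁ doubleY) (length (A ++ B)) (length (A ++ B) + length (Y ++ Y ++ I))
    dec = decomposition⁺ (proj₁ doubleY) (A ++ B) (Y ++ Y ++ I) s₁≡ (Allₚ.++⁺ allY allYI)

    longer : a + (d + v) ∸ a < length (A ++ B) + length (Y ++ Y ++ I) ∸ length (A ++ B)
    longer = subst₂ _<_ (sym (m+n∸m≡n a (d + v)))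
      (trans (sym (trans (length-++ Y) (cong₂ _+_ (length-segment f a d)
          (trans (length-++ Y) (cong₂ _+_ (length-segment f a d) (length-segment f (a + d) v))))))
        (sym (m+n∸m≡n (length (A ++ B)) (length (Y ++ Y ++ I)))))
      (+-monoˡ-< (d + v) 0<d)

  -- The mirror image: the turns X are cut from the end of the interior and run twice, and the loop
  -- Y of the suffix is dropped.
  no-suffix-loop : ∀ a v d z m r {n} → n ≡ a + (v + d) + z + d + r → (s : Sequence (suc k) n) → IsViterbiSequence s →
    d ≡ m * q → 0 < d → extend s (a + (v + d) + z) ≡ extend s (a + (v + d) + z + d) →
    ¬ Arrangement c s a (a + (v + d))
  no-suffix-loop a v d z m r refl s viterbi d≡ 0<d loop arr = <⇒≱ longer (maximal (proj₁ doubleX) _ _ (doubleX-equivalent (cycle-deterministic allX)) dec)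
    where
    open Arrangement arr
    f : ℕ → Fin (suc k)
    f = extend s
    b : ℕ
    b = a + (v + d)
    P I X B Y S : List (Edge (suc k))
    P = segment f 0 a
    I = segment f a v
    X = segment f (a + v) d
    B = segment f b z
    Y = segment f (b + z) d
    S = segment f (b + z + d) r

    interior≡ : segment f a (v + d) ≡ I ++ X
    interior≡ = segment-++ f a v

    s≡₃ : transitions s ≡ P ++ segment f a (v + d) ++ B ++ Y ++ S
    s≡₃ = begin
      transitions s                                       ≡⟨ transitions-segment s ⟩
      segment f 0 (b + z + d + r)                         ≡⟨ segment-++ f 0 (b + z + d) ⟩
      segment f 0 (b + z + d) ++ S                        ≡⟨ cong (_++ S) (segment-++ f 0 (b + z)) ⟩
      (segment f 0 (b + z) ++ Y) ++ S                     ≡⟨ cong (λ l → (l ++ Y) ++ S) (segment-++ f 0 b) ⟩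
      ((segment f 0 b ++ B) ++ Y) ++ S                    ≡⟨ cong (λ l → ((l ++ B) ++ Y) ++ S) (segment-++ f 0 a) ⟩
      (((P ++ J) ++ B) ++ Y) ++ S                         ≡⟨ ++-assoc ((P ++ J) ++ B) Y S ⟩
      ((P ++ J) ++ B) ++ Y ++ S                           ≡⟨ ++-assoc (P ++ J) B (Y ++ S) ⟩
      (P ++ J) ++ B ++ Y ++ S                             ≡⟨ ++-assoc P J (B ++ Y ++ S) ⟩
      P ++ J ++ B ++ Y ++ S                               ∎
      where
      open ≡-Reasoning
      J : List (Edge (suc k))
      J = segment f a (v + d)

    s≡ : transitions s ≡ (P ++ I) ++ X ++ B ++ Y ++ S
    s≡ = begin
      transitions s                                       ≡⟨ s≡₃ ⟩
      P ++ segment f a (v + d) ++ B ++ Y ++ S             ≡⟨ cong (λ l → P ++ l ++ B ++ Y ++ S) interior≡ ⟩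
      P ++ (I ++ X) ++ B ++ Y ++ S                        ≡⟨ cong (P ++_) (++-assoc I X (B ++ Y ++ S)) ⟩
      P ++ I ++ X ++ B ++ Y ++ S                          ≡⟨ ++-assoc P I (X ++ B ++ Y ++ S) ⟨
      (P ++ I) ++ X ++ B ++ Y ++ S                        ∎
      where open ≡-Reasoning

    allIX : All (CycleTransition c) (I ++ X)
    allIX = subst (All (CycleTransition c)) interior≡
      (decomposition⁻ s P (segment f a (v + d)) s≡₃ (length-segment f 0 a)
        (cong₂ _+_ (length-segment f 0 a) (length-segment f a (v + d))) decomposition)

    allX : All (CycleTransition c) X
    allX = Allₚ.++⁻ʳ I allIX

    wX : Walk (f (a + v)) X (f b)
    wX = subst (Walk (f (a + v)) X ∘ f) (+-assoc a v d) (segment-walk f (a + v) d)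

    closed : f b ≡ f (a + v)
    closed = walk-closed c c-injective wX allX m (trans (length-segment f (a + v) d) d≡)

    open Exchange s viterbi s≡ (segment-walk f 0 a ++ʷ segment-walk f a v)
      (subst (Walk (f (a + v)) X) closed wX)
      (subst (λ u → Walk u B (f (b + z))) closed (segment-walk f b z))
      (subst (Walk (f (b + z)) Y) (sym loop) (segment-walk f (b + z) d))
      (subst (λ u → Walk u S (f (b + z + d + r))) (sym loop) (segment-walk f (b + z + d) r))
      (trans (length-segment f (a + v) d) (sym (length-segment f (b + z) d)))

    s₂≡ : transitions (proj₁ doubleX) ≡ P ++ ((I ++ X) ++ X) ++ B ++ S
    s₂≡ = begin
      transitions (proj₁ doubleX)         ≡⟨ proj₂ (proj₂ doubleX) ⟩
      (P ++ I) ++ X ++ X ++ B ++ S        ≡⟨ ++-assoc P I (X ++ X ++ B ++ S) ⟩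
      P ++ I ++ X ++ X ++ B ++ S          ≡⟨ cong (P ++_) (++-assoc I X (X ++ B ++ S)) ⟨
      P ++ (I ++ X) ++ X ++ B ++ S        ≡⟨ cong (P ++_) (++-assoc (I ++ X) X (B ++ S)) ⟨
      P ++ ((I ++ X) ++ X) ++ B ++ S      ∎
      where open ≡-Reasoning

    dec : Decomposition c (proj₁ doubleX) (length P) (length P + length ((I ++ X) ++ X))
    dec = decomposition⁺ (proj₁ doubleX) P ((I ++ X) ++ X) s₂≡ (Allₚ.++⁺ allIX allX)

    longer : a + (v + d) ∸ a < length P + length ((I ++ X) ++ X) ∸ length P
    longer = subst₂ _<_ (sym (m+n∸m≡n a (v + d)))
      (trans (sym (trans (length-++ (I ++ X)) (cong₂ _+_
          (trans (length-++ I) (cong₂ _+_ (length-segment f a v) (length-segment f (a + v) d)))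
          (length-segment f (a + v) d))))
        (sym (m+n∸m≡n (length P) (length ((I ++ X) ++ X)))))
      (subst (_< v + d + d) (+-identityʳ (v + d)) (+-monoʳ-< (v + d) 0<d))

  private
    0<suc*q : ∀ o → 0 < suc o * q
    0<suc*q o = ≤-trans (>-nonZero⁻¹ q) (m≤m+n q (o * q))

  module _ {n : ℕ} (s : Sequence (suc k) n) (viterbi : IsViterbiSequence s) {a b : ℕ}
    (arr : Arrangement c s a b) (kq≤ : suc k * q ≤ b ∸ a) where

    open Arrangement arr
    open Decomposition decomposition

    private
      -- Only every `q`-th position is sampled, so that the loop found has a length that whole turns
      -- of the cycle can match.
      repeated : ∀ l → ∃[ i ] ∃[ o ] ((i + suc o) * q ≤ suc k * q ×
        extend s (l + i * q) ≡ extend s (l + i * q + suc o * q))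
      repeated l with Finₚ.pigeonhole (n<1+n (suc k)) (λ i → extend s (l + toℕ i * q))
      ... | i , j , i<j , same with m≤n⇒∃[o]m+o≡n i<j
      ... | o , i+o≡j = toℕ i , o , *-monoˡ-≤ q (≤-trans (≤-reflexive i+1+o≡j) (Finₚ.toℕ≤pred[n] j)) ,
        trans same (cong (extend s) (trans (cong (λ t → l + t * q) (sym i+1+o≡j))
          (trans (cong (l +_) (*-distribʳ-+ q (toℕ i) (suc o))) (sym (+-assoc l (toℕ i * q) (suc o * q))))))
        where
        i+1+o≡j : toℕ i + suc o ≡ toℕ j
        i+1+o≡j = trans (+-suc (toℕ i) o) i+o≡j

    prefix-short : a < suc k * q
    prefix-short = ≰⇒> λ kq≤a → long kq≤a (repeated 0)
      where
      long : suc k * q ≤ a → ¬ (∃[ i ] ∃[ o ] ((i + suc o) * q ≤ suc k * q × extend s (i * q) ≡ extend s (i * q + suc o * q)))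
      long kq≤a (i , o , j≤ , loop)
        with m≤n⇒∃[o]m+o≡n (≤-trans (≤-reflexive (sym (*-distribʳ-+ q i (suc o)))) (≤-trans j≤ kq≤a))
           | m≤n⇒∃[o]m+o≡n (≤-trans (≤-trans (*-monoˡ-≤ q (m≤n+m (suc o) i)) j≤) kq≤)
           | m≤n⇒∃[o]m+o≡n a≤b | m≤n⇒∃[o]m+o≡n b≤n
      ... | z , refl | v , d+v≡ | t , refl | w , refl with trans d+v≡ (m+n∸m≡n (i * q + suc o * q + z) t)
      ... | refl = no-prefix-loop (i * q) (suc o * q) z v w (suc o) s viterbi refl (0<suc*q o) loop arr

    suffix-short : n ∸ b < suc k * q
    suffix-short = ≰⇒> λ kq≤ → long kq≤ (repeated b)
      where
      long : suc k * q ≤ n ∸ b → ¬ (∃[ i ] ∃[ o ] ((i + suc o) * q ≤ suc k * q × extend s (b + i * q) ≡ extend s (b + i * q + suc o * q)))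
      long kq≤n∸b (i , o , j≤ , loop)
        with m≤n⇒∃[o]m+o≡n (≤-trans (≤-reflexive (sym (*-distribʳ-+ q i (suc o)))) (≤-trans j≤ kq≤n∸b))
           | m≤n⇒∃[o]m+o≡n (≤-trans (≤-trans (*-monoˡ-≤ q (m≤n+m (suc o) i)) j≤) kq≤)
           | m≤n⇒∃[o]m+o≡n a≤b | m≤n⇒∃[o]m+o≡n b≤n
      ... | r , r≡ | v , d+v≡ | t , refl | w , refl
        with trans (+-comm v (suc o * q)) (trans d+v≡ (m+n∸m≡n a t)) | trans r≡ (m+n∸m≡n (a + t) w)
      ... | refl | refl = no-suffix-loop a v (suc o * q) (i * q) (suc o) r
        (trans (cong (b +_) (+-assoc (i * q) (suc o * q) r)) (trans (sym (+-assoc b (i * q) (suc o * q + r)))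
          (sym (+-assoc (b + i * q) (suc o * q) r))))
        s viterbi refl (0<suc*q o) loop arr

proposition3p3 : ∀ (k : ℕ) → 1 ≤ k → ∃[ L ] (∀ (n : ℕ) (s : Sequence k n) → IsViterbiSequence s →
    ∀ (p : ℕ) .{{_ : NonZero p}} (c : Fin p → Fin k) → Injective _≡_ _≡_ c →
    ∀ (a b : ℕ) → Arrangement c s a b → L ≤ b ∸ a → a ≤ k * p × n ∸ b ≤ k * p)
proposition3p3 (suc k) _ = suc k * suc k , λ n s viterbi p c c-injective a b arr L≤ →
  -- Distinct cycle states give p ≤ k, so an interior of k² transitions has room for the k turns
  -- that a loop in the prefix or suffix may call for.
  let kp≤ = ≤-trans (*-monoʳ-≤ (suc k) (Finₚ.injective⇒≤ c-injective)) L≤ in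
  <⇒≤ (prefix-short c c-injective s viterbi arr kp≤) , <⇒≤ (suffix-short c c-injective s viterbi arr kp≤)
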